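{- Let $B$ be a commutative Bézout domain. Then given any pp $\mathcal L_{B,V}$-formula $\phi(\mathbf z)$, there exist finitely many constructible subsets $C_{\phi,k}$ of $MSpec(B)$, $k\in K$, $K$ finite, such that for any $\mathcal M\in C_{\phi,k}$, $\phi(\mathbf z)$ is equivalent to a conjunction $\chi_k(\mathbf z)$ of atomic $\mathcal L_{B_{\mathcal M},V}$-formulas, in the classes $Mod_{B_{\mathcal M}}$ of all $B_{\mathcal M}$-modules. In particular, for $\mathcal M\in MSpec(B)$, any pp $\mathcal L_{B,V}$-formula $\phi(z)$ in one variable is equivalent in $Mod_{B_{\mathcal M}}$ to a formula of the form $$z.a=0\ \wedge\ \bigwedge_{i=1}^n V_{\delta_i}(z.b_i),$$ for some $a\in B_{\mathcal M}$, nonzero $b_i\in B_{\mathcal M}$ and $\delta_i\in\Gamma(B_{\mathcal M})^+$, $1\le i\le n$, with $\delta_1\cdot v_{\mathcal M}(b_1)^{ -1}>\cdots>\delta_n\cdot v_{\mathcal M}(b_n)^{ -1}$ and $v_{\mathcal M}(b_1)>\cdots>v_{\mathcal M}(b_n)$.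
   Context: Rings are commutative integral domains with $1$; $B$ is Bézout if every finitely generated ideal is principal. $Q(B)$ is the fraction field, $U$ the group of units of $B$, and $\Gamma(B)=Q(B)^\times/U$ the group of divisibility (written multiplicatively), ordered by $aU\le bU$ iff $ba^{ -1}\in B$; its positive part is $\Gamma(B)^+=\{aU: a\in B\setminus\{0\}\}$, and $v(a)=aU$. $MSpec(B)$ is the set of maximal ideals of $B$; its basic closed sets are $V(a)=\{\mathcal M\in MSpec(B): a\in\mathcal M\}$, $a\in B$, and the constructible subsets are the elements of the Boolean algebra generated by the sets $V(a)$. For $\mathcal M\in MSpec(B)$, $B_{\mathcal M}$ is the localization of $B$ at $\mathcal M$ (a valuation domain), $\Gamma(B_{\mathcal M})$ is its (totally ordered) value group, $v_{\mathcal M}$ its valuation, and $\delta_{\mathcal M}$ is the image in $\Gamma(B_{\mathcal M})$ of $\delta\in\Gamma(B)$. For a Bézout domain $R$, $\mathcal L_R=\{+,-,0,\cdot a: a\in R\}$ is the language of $R$-modules and $\mathcal L_{R,V}=\mathcal L_R\cup\{V_\delta:\delta\in\Gamma(R)^+\}$ with unary predicates $V_\delta$. Every $R$-module $N$ is regarded as an $\mathcal L_{R,V}$-structure by $V_\delta(N)=\{m\in N:\exists n\in N\ m=n.a\}$ where $\delta=v(a)$, $a\in R\setminus\{0\}$. A $B_{\mathcal M}$-module is also an $\mathcal L_{B,V}$-structure (via $B\to B_{\mathcal M}$), and there $V_\delta=V_{\delta_{\mathcal M}}$ for $\delta\in\Gamma(B)^+$. A pp (positive primitive) formula is one of the form $\exists\mathbf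 x\,\theta(\mathbf x,\mathbf z)$ with $\theta$ a conjunction of atomic formulas. That $\chi_k$ is a single conjunction of atomic $\mathcal L_{B_{\mathcal M},V}$-formulas for all $\mathcal M\in C_{\phi,k}$ means: its scalars are elements of $Q(B)$ that lie in $B_{\mathcal M}$ for every $\mathcal M\in C_{\phi,k}$, and its predicates are $V_\delta$ with $\delta\in\Gamma(B)$ such that $\delta_{\mathcal M}\in\Gamma(B_{\mathcal M})^+$ for every $\mathcal M\in C_{\phi,k}$, $V_\delta$ being read as $V_{\delta_{\mathcal M}}$ in $B_{\mathcal M}$-modules. -}

module Defs where

open import Algebra.Bundles using (CommutativeRing; AbelianGroup)
open import Algebra.Definitions using (Invertible)
open import Algebra.Module.Bundles using (Module)
open import Data.Fin.Base using (Fin; zero; _<_)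
open import Data.List.Base using (List; _∷_; map; tabulate)
open import Data.List.Relation.Unary.All using (All)
open import Data.Nat.Base using (ℕ)
open import Data.Product.Base using (Σ; ∃; _×_; _,_; proj₁; proj₂)
open import Data.Sum.Base using (_⊎_; inj₁; inj₂; [_,_]′)
open import Function.Base using (_∘_)
open import Function.Bundles using (_⇔_)
open import Level using (Level; _⊔_; Lift) renaming (suc to lsuc)
open import Relation.Binary.Core using (Rel)
open import Relation.Binary.Structures using (IsEquivalence)
open import Relation.Nullary using (¬_)
open import Relation.Unary using (Pred)
import Algebra.Properties.AbelianGroup as AbelianGroupProperties
import Algebra.Properties.CommutativeSemigroup as CommutativeSemigroupProperties
import Algebra.Properties.Monoid.Sum as Sum
import Algebra.Properties.Ring as RingProperties
import Algebra.Solver.Ring.NaturalCoefficients.Default as NaturalSolver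
import Relation.Binary.Reasoning.Setoid as SetoidReasoning

private variable
  c ℓ p : Level

record IntegralDomain c ℓ : Set (lsuc (c ⊔ ℓ)) where
  field
    commutativeRing : CommutativeRing c ℓ
  open CommutativeRing commutativeRing public
  field
    1≉0          : 1# ≉ 0#
    zero-product : ∀ x y → x * y ≈ 0# → x ≈ 0# ⊎ y ≈ 0#

record Ideal (R : CommutativeRing c ℓ) p : Set (c ⊔ ℓ ⊔ lsuc p) where
  open CommutativeRing R
  field
    Member   : Pred Carrier p
    resp     : ∀ {x y} → x ≈ y → Member x → Member y
    0∈       : Member 0#
    +-closed : ∀ {x y} → Member x → Member y → Member (x + y)
    absorb   : ∀ {x} r → Member x → Member (r * x)

module _ {c ℓ} (R : CommutativeRing c ℓ) where
  open CommutativeRing R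
  open Sum +-monoid using (sum)

  IsFinitelyGenerated : Ideal R p → Set (c ⊔ ℓ ⊔ p)
  IsFinitelyGenerated I =
    Σ ℕ λ n → Σ (Fin n → Carrier) λ g →
    ∀ x → Ideal.Member I x ⇔
          Σ (Fin n → Carrier) (λ r → x ≈ sum (λ i → r i * g i))

  IsPrincipal : Ideal R p → Set (c ⊔ ℓ ⊔ p)
  IsPrincipal I =
    Σ Carrier λ a → ∀ x → Ideal.Member I x ⇔ Σ Carrier (λ r → x ≈ r * a)

-- The level c ⊔ ℓ is closed under forming the ideals I + (a), so ideals of
-- this level suffice for testing maximality and the Bézout property.

record BézoutDomain c ℓ : Set (lsuc (c ⊔ ℓ)) where
  field
    integralDomain : IntegralDomain c ℓ
  open IntegralDomain integralDomain public
  field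
    bézout : (I : Ideal commutativeRing (c ⊔ ℓ)) →
             IsFinitelyGenerated commutativeRing I →
             IsPrincipal commutativeRing I

record MaximalIdeal (R : CommutativeRing c ℓ) : Set (lsuc (c ⊔ ℓ)) where
  open CommutativeRing R using (1#)
  field
    ideal : Ideal R (c ⊔ ℓ)
  open Ideal ideal public
  field
    proper  : ¬ Member 1#
    maximal : (J : Ideal R (c ⊔ ℓ)) → (∀ {x} → Member x → Ideal.Member J x) →
              ¬ Ideal.Member J 1# → ∀ {x} → Ideal.Member J x → Member x

data Constructible (R : CommutativeRing c ℓ) : Set c where
  V       : CommutativeRing.Carrier R → Constructible R
  ∁       : Constructible R → Constructible R
  _∩_ _∪_ : Constructible R → Constructible R → Constructible R

infix 4 _∈_

_∈_ : {R : CommutativeRing c ℓ} → MaximalIdeal R → Constructible R → Set (c ⊔ ℓ)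
M ∈ V a     = MaximalIdeal.Member M a
M ∈ ∁ C     = ¬ M ∈ C
M ∈ (C ∩ D) = M ∈ C × M ∈ D
M ∈ (C ∪ D) = M ∈ C ⊎ M ∈ D

module _ {c ℓ} (D : IntegralDomain c ℓ) where
  open IntegralDomain D

  nonzero-* : ∀ {x y} → x ≉ 0# → y ≉ 0# → x * y ≉ 0#
  nonzero-* {x} {y} x≉0 y≉0 xy≈0 = [ x≉0 , y≉0 ]′ (zero-product x y xy≈0)

  *-cancelʳ-nonzero : ∀ x y {z} → z ≉ 0# → x * z ≈ y * z → x ≈ y
  *-cancelʳ-nonzero x y {z} z≉0 xz≈yz with zero-product (x - y) z (begin
    (x - y) * z    ≈⟨ [y-z]x≈yx-zx z x y ⟩
    x * z - y * z  ≈⟨ +-congʳ xz≈yz ⟩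
    y * z - y * z  ≈⟨ -‿inverseʳ _ ⟩
    0#             ∎)
    where open SetoidReasoning setoid
          open RingProperties ring using ([y-z]x≈yx-zx)
  ... | inj₁ x-y≈0 = RingProperties.x∙y⁻¹≈ε⇒x≈y ring x y x-y≈0
  ... | inj₂ z≈0 with () ← z≉0 z≈0

record MultiplicativeSubset (D : IntegralDomain c ℓ) p : Set (c ⊔ ℓ ⊔ lsuc p) where
  open IntegralDomain D
  field
    Member   : Pred Carrier p
    1∈       : Member 1#
    *-closed : ∀ {x y} → Member x → Member y → Member (x * y)
    nonzero  : ∀ {x} → Member x → x ≉ 0#

module Localize {c ℓ p} (D : IntegralDomain c ℓ) (S : MultiplicativeSubset D p) where
  open IntegralDomain D
  open MultiplicativeSubset S
  open NaturalSolver commutativeSemiring using (solve; _:=_; _:*_; _:+_)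
  open SetoidReasoning setoid

  record Fraction : Set (c ⊔ p) where
    constructor _/_⟨_⟩
    field
      num   : Carrier
      den   : Carrier
      den∈S : Member den

  open Fraction public

  -- As S consists of non-zero-divisors, equality of fractions needs no extra
  -- multiplier from S.

  infix 4 _≃_

  _≃_ : Rel Fraction ℓ
  x ≃ y = num x * den y ≈ num y * den x

  _⊕_ _⊗_ : Fraction → Fraction → Fraction
  (a / s ⟨ s∈ ⟩) ⊕ (b / t ⟨ t∈ ⟩) = (a * t + b * s) / (s * t) ⟨ *-closed s∈ t∈ ⟩
  (a / s ⟨ s∈ ⟩) ⊗ (b / t ⟨ t∈ ⟩) = (a * b) / (s * t) ⟨ *-closed s∈ t∈ ⟩

  ⊖_ : Fraction → Fraction
  ⊖ (a / s ⟨ s∈ ⟩) = (- a) / s ⟨ s∈ ⟩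

  ι : Carrier → Fraction
  ι a = a / 1# ⟨ 1∈ ⟩

  private
    same-terms : ∀ {a b s t} → a ≈ b → s ≈ t → a * t ≈ b * s
    same-terms p q = *-cong p (sym q)

    ≃-trans : ∀ {x y z} → x ≃ y → y ≃ z → x ≃ z
    ≃-trans {a / s ⟨ _ ⟩} {b / t ⟨ t∈ ⟩} {e / u ⟨ _ ⟩} at≈bs bu≈et =
      *-cancelʳ-nonzero D (a * u) (e * s) (nonzero t∈) (begin
        a * u * t   ≈⟨ swap a u t ⟩
        a * t * u   ≈⟨ *-congʳ at≈bs ⟩
        b * s * u   ≈⟨ swap b s u ⟩
        b * u * s   ≈⟨ *-congʳ bu≈et ⟩
        e * t * s   ≈⟨ swap e t s ⟩
        e * s * t   ∎)
      where open CommutativeSemigroupProperties *-commutativeSemigroup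
              renaming (xy∙z≈xz∙y to swap)

    ⊕-cong : ∀ {x x′ y y′} → x ≃ x′ → y ≃ y′ → (x ⊕ y) ≃ (x′ ⊕ y′)
    ⊕-cong {a / s ⟨ _ ⟩} {a′ / s′ ⟨ _ ⟩} {b / t ⟨ _ ⟩} {b′ / t′ ⟨ _ ⟩} p q = begin
      (a * t + b * s) * (s′ * t′)                ≈⟨ split a b s t s′ t′ ⟩
      (a * s′) * (t * t′) + (b * t′) * (s * s′)  ≈⟨ +-cong (*-congʳ p) (*-congʳ q) ⟩
      (a′ * s) * (t * t′) + (b′ * t) * (s * s′)  ≈⟨ merge a′ b′ s t s′ t′ ⟩
      (a′ * t′ + b′ * s′) * (s * t)              ∎
      where
      split : ∀ a b s t s′ t′ → (a * t + b * s) * (s′ * t′) ≈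
                                (a * s′) * (t * t′) + (b * t′) * (s * s′)
      split = solve 6 (λ a b s t s′ t′ → (a :* t :+ b :* s) :* (s′ :* t′) :=
                (a :* s′) :* (t :* t′) :+ (b :* t′) :* (s :* s′)) refl
      merge : ∀ a b s t s′ t′ → (a * s) * (t * t′) + (b * t) * (s * s′) ≈
                                (a * t′ + b * s′) * (s * t)
      merge = solve 6 (λ a b s t s′ t′ →
                (a :* s) :* (t :* t′) :+ (b :* t) :* (s :* s′) :=
                (a :* t′ :+ b :* s′) :* (s :* t)) refl

    ⊗-cong : ∀ {x x′ y y′} → x ≃ x′ → y ≃ y′ → (x ⊗ y) ≃ (x′ ⊗ y′)
    ⊗-cong p q =
      trans (interchange _ _ _ _) (trans (*-cong p q) (interchange _ _ _ _))
      where open CommutativeSemigroupProperties *-commutativeSemigroup using (interchange)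

    ⊖-cong : ∀ {x y} → x ≃ y → (⊖ x) ≃ (⊖ y)
    ⊖-cong {a / s ⟨ _ ⟩} {b / t ⟨ _ ⟩} p = begin
      - a * t    ≈⟨ -‿distribˡ-* a t ⟨
      - (a * t)  ≈⟨ -‿cong p ⟩
      - (b * s)  ≈⟨ -‿distribˡ-* b s ⟩
      - b * s    ∎
      where open RingProperties ring using (-‿distribˡ-*)

    ⊕-assoc : ∀ x y z → ((x ⊕ y) ⊕ z) ≃ (x ⊕ (y ⊕ z))
    ⊕-assoc (a / s ⟨ _ ⟩) (b / t ⟨ _ ⟩) (e / u ⟨ _ ⟩) =
      same-terms (solve 6 (λ a s b t e u →
        (a :* t :+ b :* s) :* u :+ e :* (s :* t) :=
        a :* (t :* u) :+ (b :* u :+ e :* t) :* s) refl a s b t e u) (*-assoc s t u)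

    ⊕-comm : ∀ x y → (x ⊕ y) ≃ (y ⊕ x)
    ⊕-comm x y = same-terms (+-comm _ _) (*-comm _ _)

    ⊕-identityˡ : ∀ x → (ι 0# ⊕ x) ≃ x
    ⊕-identityˡ (a / s ⟨ _ ⟩) =
      same-terms (trans (+-cong (zeroˡ s) (*-identityʳ a)) (+-identityˡ a)) (*-identityˡ s)

    ⊕-inverseˡ : ∀ x → ((⊖ x) ⊕ x) ≃ ι 0#
    ⊕-inverseˡ (a / s ⟨ _ ⟩) = begin
      (- a * s + a * s) * 1#  ≈⟨ *-identityʳ _ ⟩
      - a * s + a * s         ≈⟨ distribʳ s (- a) a ⟨
      (- a + a) * s           ≈⟨ *-congʳ (-‿inverseˡ a) ⟩
      0# * s                  ≈⟨ zeroˡ s ⟩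
      0#                      ≈⟨ zeroˡ (s * s) ⟨
      0# * (s * s)            ∎

    ⊗-assoc : ∀ x y z → ((x ⊗ y) ⊗ z) ≃ (x ⊗ (y ⊗ z))
    ⊗-assoc x y z = same-terms (*-assoc _ _ _) (*-assoc _ _ _)

    ⊗-comm : ∀ x y → (x ⊗ y) ≃ (y ⊗ x)
    ⊗-comm x y = same-terms (*-comm _ _) (*-comm _ _)

    ⊗-identityˡ : ∀ x → (ι 1# ⊗ x) ≃ x
    ⊗-identityˡ x = same-terms (*-identityˡ _) (*-identityˡ _)

    ⊗-distribʳ : ∀ x y z → ((y ⊕ z) ⊗ x) ≃ ((y ⊗ x) ⊕ (z ⊗ x))
    ⊗-distribʳ (a / s ⟨ _ ⟩) (b / t ⟨ _ ⟩) (e / u ⟨ _ ⟩) =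
      solve 6 (λ a s b t e u →
        ((b :* u :+ e :* t) :* a) :* ((t :* s) :* (u :* s)) :=
        ((b :* a) :* (u :* s) :+ (e :* a) :* (t :* s)) :* ((t :* u) :* s))
        refl a s b t e u

  ≃-isEquivalence : IsEquivalence _≃_
  ≃-isEquivalence = record
    { refl  = refl
    ; sym   = sym
    ; trans = λ {x} {y} {z} → ≃-trans {x} {y} {z}
    }

  localizedRing : CommutativeRing (c ⊔ p) ℓ
  localizedRing = record
    { Carrier = Fraction
    ; _≈_ = _≃_
    ; _+_ = _⊕_
    ; _*_ = _⊗_
    ; -_  = ⊖_
    ; 0#  = ι 0#
    ; 1#  = ι 1#
    ; isCommutativeRing = record
      { isRing = record
        { +-isAbelianGroup = record
          { isGroup = record
            { isMonoid = record
              { isSemigroup = record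
                { isMagma = record
                  { isEquivalence = ≃-isEquivalence
                  ; ∙-cong = λ {x} {x′} {y} {y′} → ⊕-cong {x} {x′} {y} {y′}
                  }
                ; assoc = ⊕-assoc
                }
              ; identity = ⊕-identityˡ , λ x →
                  ≃-trans {x ⊕ ι 0#} {ι 0# ⊕ x} {x} (⊕-comm x (ι 0#)) (⊕-identityˡ x)
              }
            ; inverse = ⊕-inverseˡ , λ x →
                ≃-trans {x ⊕ (⊖ x)} {(⊖ x) ⊕ x} {ι 0#} (⊕-comm x (⊖ x)) (⊕-inverseˡ x)
            ; ⁻¹-cong = λ {x} {y} → ⊖-cong {x} {y}
            }
          ; comm = ⊕-comm
          }
        ; *-cong = λ {x} {x′} {y} {y′} → ⊗-cong {x} {x′} {y} {y′}
        ; *-assoc = ⊗-assoc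
        ; *-identity = ⊗-identityˡ , λ x →
            ≃-trans {x ⊗ ι 1#} {ι 1# ⊗ x} {x} (⊗-comm x (ι 1#)) (⊗-identityˡ x)
        ; distrib = (λ x y z →
            ≃-trans {x ⊗ (y ⊕ z)} {(y ⊕ z) ⊗ x} {(x ⊗ y) ⊕ (x ⊗ z)} (⊗-comm x (y ⊕ z))
              (≃-trans {(y ⊕ z) ⊗ x} {(y ⊗ x) ⊕ (z ⊗ x)} {(x ⊗ y) ⊕ (x ⊗ z)}
                (⊗-distribʳ x y z)
                (⊕-cong {y ⊗ x} {x ⊗ y} {z ⊗ x} {x ⊗ z} (⊗-comm y x) (⊗-comm z x))))
            , ⊗-distribʳ
        }
      ; *-comm = ⊗-comm
      }
    }

  ≃0⇒num≈0 : ∀ x → x ≃ ι 0# → num x ≈ 0#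
  ≃0⇒num≈0 x x≃0 = begin
    num x       ≈⟨ *-identityʳ _ ⟨
    num x * 1#  ≈⟨ x≃0 ⟩
    0# * den x  ≈⟨ zeroˡ _ ⟩
    0#          ∎

  num≈0⇒≃0 : ∀ x → num x ≈ 0# → x ≃ ι 0#
  num≈0⇒≃0 x num≈0 = begin
    num x * 1#  ≈⟨ *-identityʳ _ ⟩
    num x       ≈⟨ num≈0 ⟩
    0#          ≈⟨ zeroˡ _ ⟨
    0# * den x  ∎

  localization : IntegralDomain (c ⊔ p) ℓ
  localization = record
    { commutativeRing = localizedRing
    ; 1≉0 = 1≉0 ∘ ≃0⇒num≈0 (ι 1#)
    ; zero-product = λ x y xy≃0 →
        [ inj₁ ∘ num≈0⇒≃0 x , inj₂ ∘ num≈0⇒≃0 y ]′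
          (zero-product (num x) (num y) (≃0⇒num≈0 (x ⊗ y) xy≃0))
    }

  ι-nonzero : ∀ {a} → a ≉ 0# → ¬ ι a ≃ ι 0#
  ι-nonzero a≉0 = a≉0 ∘ ≃0⇒num≈0 (ι _)

nonzeroElements : (D : IntegralDomain c ℓ) → MultiplicativeSubset D ℓ
nonzeroElements D = record
  { Member   = _≉ 0#
  ; 1∈       = 1≉0
  ; *-closed = nonzero-* D
  ; nonzero  = λ x≉0 → x≉0
  } where open IntegralDomain D

module FractionField {c ℓ} (D : IntegralDomain c ℓ) =
  Localize D (nonzeroElements D)

module Divisibility {c ℓ} (D : IntegralDomain c ℓ) where
  open IntegralDomain D
  open FractionField D
  private
    module Q = CommutativeRing localizedRing

  Qˣ : AbelianGroup (c ⊔ ℓ) ℓ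
  Qˣ = record
    { Carrier = Σ Fraction (Q._≉ Q.0#)
    ; _≈_ = λ x y → proj₁ x Q.≈ proj₁ y
    ; _∙_ = λ (x , x≉0) (y , y≉0) → (x Q.* y) , nonzero-* localization {x} {y} x≉0 y≉0
    ; ε   = Q.1# , IntegralDomain.1≉0 localization
    ; _⁻¹ = λ (x , x≉0) →
        let a≉0 = x≉0 ∘ num≈0⇒≃0 x
            y   = den x / num x ⟨ a≉0 ⟩
        in y , den∈S x ∘ ≃0⇒num≈0 y
    ; isAbelianGroup = record
      { isGroup = record
        { isMonoid = record
          { isSemigroup = record
            { isMagma = record
              { isEquivalence = record
                { refl  = λ {(x , _)} → Q.refl {x}
                ; sym   = λ {(x , _)} {(y , _)} → Q.sym {x} {y}
                ; trans = λ {(x , _)} {(y , _)} {(z , _)} → Q.trans {x} {y} {z}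
                }
              ; ∙-cong = λ {(x , _)} {(y , _)} {(u , _)} {(v , _)} → Q.*-cong {x} {y} {u} {v}
              }
            ; assoc = λ (x , _) (y , _) (z , _) → Q.*-assoc x y z
            }
          ; identity = (λ (x , _) → Q.*-identityˡ x) , (λ (x , _) → Q.*-identityʳ x)
          }
        ; inverse = (λ (x , _) → inverseˡ x)
                  , (λ (x , _) → trans (*-congʳ (*-comm (num x) (den x)))
                                   (trans (inverseˡ x) (*-congˡ (*-comm (num x) (den x)))))
        ; ⁻¹-cong = λ {(x , _)} {(y , _)} x≈y →
            trans (*-comm (den x) (num y)) (trans (sym x≈y) (*-comm (num x) (den y)))
        }
      ; comm = λ (x , _) (y , _) → Q.*-comm x y
      }
    }
    where
    inverseˡ : ∀ x → (den x * num x) * 1# ≈ 1# * (num x * den x)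
    inverseˡ x = trans (*-identityʳ _) (trans (*-comm _ _) (sym (*-identityˡ _)))

  private
    module Qˣ = AbelianGroup Qˣ

  IsUnit : Pred Carrier (c ⊔ ℓ)
  IsUnit = Invertible _≈_ 1# _*_

  infix 4 _∈U _≈Γ_ _≤Γ_ _<Γ_

  _∈U : Pred Qˣ.Carrier (c ⊔ ℓ)
  x ∈U = ∃ λ u → IsUnit u × ι u Q.≈ proj₁ x

  -- Elements of Γ(D) are represented by elements of Q(D)ˣ, with aU = bU iff
  -- b a⁻¹ ∈ U.

  _≈Γ_ _≤Γ_ _<Γ_ : Rel Qˣ.Carrier (c ⊔ ℓ)
  a ≈Γ b = (b Qˣ.∙ a Qˣ.⁻¹) ∈U
  a ≤Γ b = ∃ λ r → ι r Q.≈ proj₁ (b Qˣ.∙ a Qˣ.⁻¹)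
  a <Γ b = a ≤Γ b × ¬ a ≈Γ b

  private
    ∈U-resp : ∀ x y → x Qˣ.≈ y → x ∈U → y ∈U
    ∈U-resp x y x≈y (u , u∈ , u≈x) =
      u , u∈ , Q.trans {ι u} {proj₁ x} {proj₁ y} u≈x x≈y

    ε∈U : Qˣ.ε ∈U
    ε∈U = 1# , (1# , *-identityˡ 1# , *-identityˡ 1#) , refl

    ∙∈U : ∀ x y → x ∈U → y ∈U → (x Qˣ.∙ y) ∈U
    ∙∈U x y (u , (u′ , u′u , uu′) , u≈) (v , (v′ , v′v , vv′) , v≈) =
      u * v ,
      (u′ * v′ , trans (interchange u′ v′ u v) (trans (*-cong u′u v′v) (*-identityˡ 1#))
               , trans (interchange u v u′ v′) (trans (*-cong uu′ vv′) (*-identityˡ 1#))) ,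
      Q.trans {ι (u * v)} {ι u Q.* ι v} {proj₁ (x Qˣ.∙ y)}
        (*-congˡ (*-identityˡ 1#)) (Q.*-cong {ι u} {proj₁ x} {ι v} {proj₁ y} u≈ v≈)
      where open CommutativeSemigroupProperties *-commutativeSemigroup using (interchange)

    ⁻¹∈U : ∀ x → x ∈U → (x Qˣ.⁻¹) ∈U
    ⁻¹∈U (x , _) (u , (u′ , u′u , uu′) , u≈x) = u′ , (u , uu′ , u′u) , (begin
      u′ * num x         ≈⟨ *-congˡ (trans (sym (*-identityʳ _)) (sym u≈x)) ⟩
      u′ * (u * den x)   ≈⟨ *-assoc u′ u (den x) ⟨
      (u′ * u) * den x   ≈⟨ *-congʳ u′u ⟩
      1# * den x         ≈⟨ *-comm 1# (den x) ⟩
      den x * 1#         ∎)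
      where open SetoidReasoning setoid

    open AbelianGroupProperties Qˣ using (⁻¹-∙-comm; ⁻¹-involutive; ⁻¹-anti-homo-∙)
    open SetoidReasoning Qˣ.setoid

    ≈⇒≈Γ : ∀ x y → x Qˣ.≈ y → x ≈Γ y
    ≈⇒≈Γ x y x≈y = ∈U-resp Qˣ.ε (y Qˣ.∙ x Qˣ.⁻¹) (begin
      Qˣ.ε             ≈⟨ Qˣ.inverseʳ x ⟨
      x Qˣ.∙ x Qˣ.⁻¹   ≈⟨ Qˣ.∙-congʳ {x Qˣ.⁻¹} {x} {y} x≈y ⟩
      y Qˣ.∙ x Qˣ.⁻¹   ∎) ε∈U

    ≈Γ-sym : ∀ x y → x ≈Γ y → y ≈Γ x
    ≈Γ-sym x y x≈y = ∈U-resp ((y Qˣ.∙ x Qˣ.⁻¹) Qˣ.⁻¹) (x Qˣ.∙ y Qˣ.⁻¹) (begin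
      (y Qˣ.∙ x Qˣ.⁻¹) Qˣ.⁻¹
        ≈⟨ ⁻¹-anti-homo-∙ y (x Qˣ.⁻¹) ⟩
      (x Qˣ.⁻¹) Qˣ.⁻¹ Qˣ.∙ y Qˣ.⁻¹
        ≈⟨ Qˣ.∙-congʳ {y Qˣ.⁻¹} {(x Qˣ.⁻¹) Qˣ.⁻¹} {x} (⁻¹-involutive x) ⟩
      x Qˣ.∙ y Qˣ.⁻¹
        ∎) (⁻¹∈U (y Qˣ.∙ x Qˣ.⁻¹) x≈y)

    ≈Γ-trans : ∀ x y z → x ≈Γ y → y ≈Γ z → x ≈Γ z
    ≈Γ-trans x y z x≈y y≈z =
      ∈U-resp ((z Qˣ.∙ y Qˣ.⁻¹) Qˣ.∙ (y Qˣ.∙ x Qˣ.⁻¹)) (z Qˣ.∙ x Qˣ.⁻¹) (begin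
        (z Qˣ.∙ y Qˣ.⁻¹) Qˣ.∙ (y Qˣ.∙ x Qˣ.⁻¹)
          ≈⟨ Qˣ.assoc z (y Qˣ.⁻¹) (y Qˣ.∙ x Qˣ.⁻¹) ⟩
        z Qˣ.∙ (y Qˣ.⁻¹ Qˣ.∙ (y Qˣ.∙ x Qˣ.⁻¹))
          ≈⟨ Qˣ.∙-congˡ {z} {y Qˣ.⁻¹ Qˣ.∙ (y Qˣ.∙ x Qˣ.⁻¹)} {(y Qˣ.⁻¹ Qˣ.∙ y) Qˣ.∙ x Qˣ.⁻¹}
               (Qˣ.sym {(y Qˣ.⁻¹ Qˣ.∙ y) Qˣ.∙ x Qˣ.⁻¹} {y Qˣ.⁻¹ Qˣ.∙ (y Qˣ.∙ x Qˣ.⁻¹)}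
                 (Qˣ.assoc (y Qˣ.⁻¹) y (x Qˣ.⁻¹))) ⟩
        z Qˣ.∙ ((y Qˣ.⁻¹ Qˣ.∙ y) Qˣ.∙ x Qˣ.⁻¹)
          ≈⟨ Qˣ.∙-congˡ {z} {(y Qˣ.⁻¹ Qˣ.∙ y) Qˣ.∙ x Qˣ.⁻¹} {Qˣ.ε Qˣ.∙ x Qˣ.⁻¹}
               (Qˣ.∙-congʳ {x Qˣ.⁻¹} {y Qˣ.⁻¹ Qˣ.∙ y} {Qˣ.ε} (Qˣ.inverseˡ y)) ⟩
        z Qˣ.∙ (Qˣ.ε Qˣ.∙ x Qˣ.⁻¹)
          ≈⟨ Qˣ.∙-congˡ {z} {Qˣ.ε Qˣ.∙ x Qˣ.⁻¹} {x Qˣ.⁻¹} (Qˣ.identityˡ (x Qˣ.⁻¹)) ⟩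
        z Qˣ.∙ x Qˣ.⁻¹
          ∎) (∙∈U (z Qˣ.∙ y Qˣ.⁻¹) (y Qˣ.∙ x Qˣ.⁻¹) y≈z x≈y)

    ∙-congΓ : ∀ x x′ y y′ → x ≈Γ x′ → y ≈Γ y′ → (x Qˣ.∙ y) ≈Γ (x′ Qˣ.∙ y′)
    ∙-congΓ x x′ y y′ p q =
      ∈U-resp ((x′ Qˣ.∙ x Qˣ.⁻¹) Qˣ.∙ (y′ Qˣ.∙ y Qˣ.⁻¹)) ((x′ Qˣ.∙ y′) Qˣ.∙ (x Qˣ.∙ y) Qˣ.⁻¹)
        (begin
        (x′ Qˣ.∙ x Qˣ.⁻¹) Qˣ.∙ (y′ Qˣ.∙ y Qˣ.⁻¹)
          ≈⟨ CommutativeSemigroupProperties.interchange Qˣ.commutativeSemigroup x′ (x Qˣ.⁻¹) y′ (y Qˣ.⁻¹) ⟩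
        (x′ Qˣ.∙ y′) Qˣ.∙ (x Qˣ.⁻¹ Qˣ.∙ y Qˣ.⁻¹)
          ≈⟨ Qˣ.∙-congˡ {x′ Qˣ.∙ y′} {x Qˣ.⁻¹ Qˣ.∙ y Qˣ.⁻¹} {(x Qˣ.∙ y) Qˣ.⁻¹} (⁻¹-∙-comm x y) ⟩
        (x′ Qˣ.∙ y′) Qˣ.∙ (x Qˣ.∙ y) Qˣ.⁻¹
          ∎) (∙∈U (x′ Qˣ.∙ x Qˣ.⁻¹) (y′ Qˣ.∙ y Qˣ.⁻¹) p q)

    ⁻¹-congΓ : ∀ x y → x ≈Γ y → (x Qˣ.⁻¹) ≈Γ (y Qˣ.⁻¹)
    ⁻¹-congΓ x y p =
      ∈U-resp ((y Qˣ.∙ x Qˣ.⁻¹) Qˣ.⁻¹) (y Qˣ.⁻¹ Qˣ.∙ (x Qˣ.⁻¹) Qˣ.⁻¹)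
        (Qˣ.sym {y Qˣ.⁻¹ Qˣ.∙ (x Qˣ.⁻¹) Qˣ.⁻¹} {(y Qˣ.∙ x Qˣ.⁻¹) Qˣ.⁻¹} (⁻¹-∙-comm y (x Qˣ.⁻¹)))
        (⁻¹∈U (y Qˣ.∙ x Qˣ.⁻¹) p)

  Γ : AbelianGroup (c ⊔ ℓ) (c ⊔ ℓ)
  Γ = record
    { Carrier = Qˣ.Carrier
    ; _≈_ = _≈Γ_
    ; _∙_ = Qˣ._∙_
    ; ε   = Qˣ.ε
    ; _⁻¹ = Qˣ._⁻¹
    ; isAbelianGroup = record
      { isGroup = record
        { isMonoid = record
          { isSemigroup = record
            { isMagma = record
              { isEquivalence = record
                { refl  = λ {x} → ≈⇒≈Γ x x (Qˣ.refl {x})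
                ; sym   = λ {x} {y} → ≈Γ-sym x y
                ; trans = λ {x} {y} {z} → ≈Γ-trans x y z
                }
              ; ∙-cong = λ {x} {x′} {y} {y′} → ∙-congΓ x x′ y y′
              }
            ; assoc = λ x y z →
                ≈⇒≈Γ ((x Qˣ.∙ y) Qˣ.∙ z) (x Qˣ.∙ (y Qˣ.∙ z)) (Qˣ.assoc x y z)
            }
          ; identity = (λ x → ≈⇒≈Γ (Qˣ.ε Qˣ.∙ x) x (Qˣ.identityˡ x))
                     , (λ x → ≈⇒≈Γ (x Qˣ.∙ Qˣ.ε) x (Qˣ.identityʳ x))
          }
        ; inverse = (λ x → ≈⇒≈Γ (x Qˣ.⁻¹ Qˣ.∙ x) Qˣ.ε (Qˣ.inverseˡ x))
                  , (λ x → ≈⇒≈Γ (x Qˣ.∙ x Qˣ.⁻¹) Qˣ.ε (Qˣ.inverseʳ x))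
        ; ⁻¹-cong = λ {x} {y} → ⁻¹-congΓ x y
        }
      ; comm = λ x y → ≈⇒≈Γ (x Qˣ.∙ y) (y Qˣ.∙ x) (Qˣ.comm x y)
      }
    }

  open AbelianGroup Γ public using (_⁻¹) renaming (_∙_ to _·_)

  ∣Γ∣ : Set (c ⊔ ℓ)
  ∣Γ∣ = AbelianGroup.Carrier Γ

  v : (a : Carrier) → a ≉ 0# → ∣Γ∣
  v a a≉0 = ι a , ι-nonzero a≉0

  IsPositive : Pred ∣Γ∣ (c ⊔ ℓ)
  IsPositive δ = Σ Carrier λ a → Σ (a ≉ 0#) λ a≉0 → δ ≈Γ v a a≉0

  Γ⁺ : Set (c ⊔ ℓ)
  Γ⁺ = Σ ∣Γ∣ IsPositive

-- S is the set of scalars, P indexes the predicates V_δ, and X is the set of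
-- variables; ℒ_{R,V} is the case where S is R and P is Γ(R)⁺.

module _ {s d} (S : Set s) (P : Set d) where

  infixl 7 _∙_
  infixl 6 _⊞_
  infix  8 ⊟_
  infix  4 _≐_

  data Term (X : Set) : Set s where
    var : X → Term X
    𝟎   : Term X
    _⊞_ : Term X → Term X → Term X
    ⊟_  : Term X → Term X
    _∙_ : Term X → S → Term X

  data Atomic (X : Set) : Set (s ⊔ d) where
    _≐_ : Term X → Term X → Atomic X
    V   : P → Term X → Atomic X

  Conjunction : Set → Set (s ⊔ d)
  Conjunction X = List (Atomic X)

  -- inj₁ marks the bound variables and inj₂ the free ones.

  record PP (n : ℕ) : Set (s ⊔ d) where
    constructor ∃⟨_⟩_
    field
      bound  : ℕ
      matrix : Conjunction (Fin bound ⊎ Fin n)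

module _ {s d s′ d′} {S : Set s} {P : Set d} {S′ : Set s′} {P′ : Set d′}
         (f : S → S′) (g : P → P′) where

  mapTerm : ∀ {X} → Term S P X → Term S′ P′ X
  mapTerm (var x) = var x
  mapTerm 𝟎       = 𝟎
  mapTerm (t ⊞ u) = mapTerm t ⊞ mapTerm u
  mapTerm (⊟ t)   = ⊟ mapTerm t
  mapTerm (t ∙ r) = mapTerm t ∙ f r

  mapAtomic : ∀ {X} → Atomic S P X → Atomic S′ P′ X
  mapAtomic (t ≐ u) = mapTerm t ≐ mapTerm u
  mapAtomic (V δ t) = V (g δ) (mapTerm t)

  mapPP : ∀ {n} → PP S P n → PP S′ P′ n
  mapPP (∃⟨ k ⟩ θ) = ∃⟨ k ⟩ map mapAtomic θ

PPFormula : IntegralDomain c ℓ → ℕ → Set (c ⊔ ℓ)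
PPFormula D = PP (IntegralDomain.Carrier D) (Divisibility.Γ⁺ D)

AtomicConjunction : IntegralDomain c ℓ → Set → Set (c ⊔ ℓ)
AtomicConjunction D = Conjunction (IntegralDomain.Carrier D) (Divisibility.Γ⁺ D)

module Semantics {c ℓ} (D : IntegralDomain c ℓ) where
  open IntegralDomain D using (Carrier; commutativeRing)
  open Divisibility D using (Γ⁺)

  module _ {m ℓm} (N : Module commutativeRing m ℓm) where
    open Module N

    eval : ∀ {X} → (X → Carrierᴹ) → Term Carrier Γ⁺ X → Carrierᴹ
    eval ρ (var x) = ρ x
    eval ρ 𝟎       = 0ᴹ
    eval ρ (t ⊞ u) = eval ρ t +ᴹ eval ρ u
    eval ρ (⊟ t)   = -ᴹ eval ρ t
    eval ρ (t ∙ r) = eval ρ t *ᵣ r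

    -- V_δ is computed from the chosen a with δ = v(a); any other choice is
    -- a unit multiple of a and gives the same submodule N.a.

    _⊨ᵃ_[_] : ∀ {X} → Atomic Carrier Γ⁺ X → (X → Carrierᴹ) → Set (m ⊔ ℓm)
    _⊨ᵃ_[_] (t ≐ u)           ρ = Lift m (eval ρ t ≈ᴹ eval ρ u)
    _⊨ᵃ_[_] (V (_ , a , _) t) ρ = Σ Carrierᴹ λ n → eval ρ t ≈ᴹ n *ᵣ a

    _⊨_[_] : ∀ {X} → AtomicConjunction D X → (X → Carrierᴹ) →
             Set (c ⊔ ℓ ⊔ m ⊔ ℓm)
    _⊨_[_] θ ρ = All (λ α → _⊨ᵃ_[_] α ρ) θ

    _⊨ᵖ_[_] : ∀ {n} → PPFormula D n → (Fin n → Carrierᴹ) →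
              Set (c ⊔ ℓ ⊔ m ⊔ ℓm)
    _⊨ᵖ_[_] (∃⟨ k ⟩ θ) z = Σ (Fin k → Carrierᴹ) λ x → _⊨_[_] θ [ x , z ]′

  EquivalentInMod : ∀ m ℓm {n} → PPFormula D n → AtomicConjunction D (Fin n) →
                    Set (c ⊔ ℓ ⊔ lsuc (m ⊔ ℓm))
  EquivalentInMod m ℓm {n} φ χ =
    (N : Module commutativeRing m ℓm) (z : Fin n → Module.Carrierᴹ N) →
    _⊨ᵖ_[_] N φ z ⇔ _⊨_[_] N χ z

-- z.a = 0 ∧ ⋀ᵢ V_{δᵢ}(z.bᵢ), with bᵢ ≠ 0 and both v(bᵢ) and δᵢ v(bᵢ)⁻¹ strictly
-- decreasing in i.

record NormalForm (D : IntegralDomain c ℓ) : Set (c ⊔ ℓ) where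
  open IntegralDomain D using (Carrier; _≉_; 0#)
  open Divisibility D
  field
    a   : Carrier
    n   : ℕ
    b   : Fin n → Carrier
    b≉0 : ∀ i → b i ≉ 0#
    δ   : Fin n → Γ⁺

  vb : Fin n → ∣Γ∣
  vb i = v (b i) (b≉0 i)

  field
    δ/vb-decreasing : ∀ {i j} → i < j → (proj₁ (δ j) · (vb j ⁻¹)) <Γ (proj₁ (δ i) · (vb i ⁻¹))
    vb-decreasing   : ∀ {i j} → i < j → vb j <Γ vb i

  formula : AtomicConjunction D (Fin 1)
  formula = (var zero ∙ a ≐ 𝟎) ∷ tabulate (λ i → V (δ i) (var zero ∙ b i))

module AtMaximal {c ℓ} (D : IntegralDomain c ℓ) where
  open IntegralDomain D
  private
    module Q = FractionField D
    module ΓD = Divisibility D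

  MSpec : Set (lsuc (c ⊔ ℓ))
  MSpec = MaximalIdeal commutativeRing

  module _ (M : MSpec) where
    open MaximalIdeal M

    private
      _+⟨_⟩ : Carrier → Ideal commutativeRing (c ⊔ ℓ)
      _+⟨_⟩ x = record
        { Member = λ y → Σ Carrier λ i → Σ Carrier λ r → Member i × y ≈ i + r * x
        ; resp = λ y≈z (i , r , i∈ , y≈) → i , r , i∈ , trans (sym y≈z) y≈
        ; 0∈ = 0# , 0# , 0∈ , sym (trans (+-identityˡ _) (zeroˡ x))
        ; +-closed = λ (i , r , i∈ , y≈) (j , r′ , j∈ , z≈) →
            i + j , r + r′ , +-closed i∈ j∈ ,
            trans (+-cong y≈ z≈)
              (solve 5 (λ i r j r′ x → (i :+ r :* x) :+ (j :+ r′ :* x) :=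
                                       (i :+ j) :+ (r :+ r′) :* x) refl i r j r′ x)
        ; absorb = λ r (i , r′ , i∈ , y≈) →
            r * i , r * r′ , absorb r i∈ ,
            trans (*-congˡ y≈) (trans (distribˡ r i (r′ * x)) (+-congˡ (sym (*-assoc r r′ x))))
        }
        where open NaturalSolver commutativeSemiring using (solve; _:=_; _:*_; _:+_)

      1∈+⟨⟩ : ∀ {x} → ¬ Member x → ¬ ¬ Ideal.Member (_+⟨_⟩ x) 1#
      1∈+⟨⟩ {x} x∉ 1∉ = x∉ (maximal (_+⟨_⟩ x)
        (λ {i} i∈ → i , 0# , i∈ , sym (trans (+-congˡ (zeroˡ x)) (+-identityʳ i))) 1∉
        (0# , 1# , 0∈ , sym (trans (+-identityˡ _) (*-identityˡ x))))

      ∉-* : ∀ {x y} → ¬ Member x → ¬ Member y → ¬ Member (x * y)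
      ∉-* {x} {y} x∉ y∉ xy∈ =
        1∈+⟨⟩ x∉ λ (i , r , i∈ , 1≈) → 1∈+⟨⟩ y∉ λ (j , r′ , j∈ , 1≈′) →
        proper (resp
          (sym (trans (sym (*-identityˡ 1#)) (trans (*-cong 1≈ 1≈′)
            (solve 6 (λ i r j r′ x y → (i :+ r :* x) :* (j :+ r′ :* y) :=
              ((j :+ r′ :* y) :* i :+ (r :* x) :* j) :+ (r :* r′) :* (x :* y))
              refl i r j r′ x y))))
          (+-closed (+-closed (absorb _ i∈) (absorb _ j∈)) (absorb _ xy∈)))
        where open NaturalSolver commutativeSemiring using (solve; _:=_; _:*_; _:+_)

    complement : MultiplicativeSubset D (c ⊔ ℓ)
    complement = record
      { Member   = λ x → ¬ Member x
      ; 1∈       = proper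
      ; *-closed = ∉-*
      ; nonzero  = λ x∉ x≈0 → x∉ (resp (sym x≈0) 0∈)
      }

    open Localize D complement public
      using () renaming (localization to atM; ι to toAtM)

  module _ (M : MSpec) where
    private
      module L  = Localize D (complement M)
      module QL = FractionField (atM M)
      module ΓL = Divisibility (atM M)

    atM⊆Q : L.Fraction → Q.Fraction
    atM⊆Q x = L.num x Q./ L.den x ⟨ MultiplicativeSubset.nonzero (complement M) (L.den∈S x) ⟩

    LiesIn : Pred Q.Fraction (c ⊔ ℓ)
    LiesIn q = Σ L.Fraction λ x → atM⊆Q x Q.≃ q

    -- The map δ ↦ δ_M, sending the class of a/b to that of (a/1)/(b/1).

    imageΓ : ΓD.∣Γ∣ → ΓL.∣Γ∣
    imageΓ (q , q≉0) =
      let q′ = L.ι (Q.num q) QL./ L.ι (Q.den q) ⟨ L.ι-nonzero (Q.den∈S q) ⟩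
      in q′ , L.ι-nonzero (q≉0 ∘ Q.num≈0⇒≃0 q) ∘ QL.≃0⇒num≈0 q′

    imageΓ-v : ∀ δ a a≉0 → δ ΓD.≈Γ ΓD.v a a≉0 →
               imageΓ δ ΓL.≈Γ ΓL.v (L.ι a) (L.ι-nonzero a≉0)
    imageΓ-v (q , _) a a≉0 (u , (u′ , u′u , uu′) , u≈) =
      L.ι u , (L.ι u′ , unit u′u , unit uu′) , *-cong core (*-assoc 1# 1# 1#)
      where
      unit : ∀ {x y} → x * y ≈ 1# → (L.ι x L.⊗ L.ι y) L.≃ L.ι 1#
      unit xy≈1 = *-cong xy≈1 (sym (*-identityˡ 1#))
      core : u * (1# * Q.num q) ≈ (a * Q.den q) * 1#
      core = u≈

    imageΓ⁺ : ΓD.Γ⁺ → ΓL.Γ⁺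
    imageΓ⁺ (δ , a , a≉0 , δ≈va) =
      imageΓ δ , L.ι a , L.ι-nonzero a≉0 , imageΓ-v δ a a≉0 δ≈va

  -- A D_M-module is an ℒ_{D,V}-structure via D → D_M and δ ↦ δ_M, so whether it
  -- satisfies φ is expressed by translating φ to a formula of ℒ_{D_M,V}.

  _at_ : ∀ {n} → PPFormula D n → (M : MSpec) → PPFormula (atM M) n
  φ at M = mapPP (toAtM M) (imageΓ⁺ M) φ

  -- Scalars of Q(D) and predicates V_δ, δ ∈ Γ(D), that make sense over D_M for
  -- every M in C.

  module _ (C : Constructible commutativeRing) where

    UniformScalar : Set (lsuc (c ⊔ ℓ))
    UniformScalar = Σ Q.Fraction λ q → ∀ M → M ∈ C → LiesIn M q

    UniformPred : Set (lsuc (c ⊔ ℓ))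
    UniformPred = Σ ΓD.∣Γ∣ λ δ → ∀ M → M ∈ C → Divisibility.IsPositive (atM M) (imageΓ M δ)

    UniformConjunction : Set → Set (lsuc (c ⊔ ℓ))
    UniformConjunction = Conjunction UniformScalar UniformPred

    specialize : ∀ {X} (M : MSpec) → M ∈ C → UniformConjunction X → AtomicConjunction (atM M) X
    specialize M M∈C = map (mapAtomic (λ (q , q∈) → proj₁ (q∈ M M∈C))
                                      (λ (δ , δ⁺) → imageΓ M δ , δ⁺ M M∈C))

{-# OPTIONS --safe #-}
module Submission where

-- Over B_M a pp formula says that B′z = Ax is solvable in x. Since divisibility in B_M is
-- total, A has an entry dividing all others; clearing its row and column splits off one
-- condition V_d(b·z) (an equation if d = 0) and leaves a smaller system. Which of two elements
-- x = x′d, y = y′d of B divides the other in B_M, where rx′ + sy′ = 1, depends only on whether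
-- x′ ∈ M: if x′ ∈ M then y′ ∉ M. So the elimination can be run simultaneously for all M, with
-- scalars in Q(B), branching finitely often on the sets V(x′).
-- In one variable, V_d(z.b) implies V_d′(z.b′) as soon as v(b) ≤ v(b′) and d′/b′ ≤ d/b, so the
-- conditions that are not implied by another one form a chain.

open import Defs
open import Algebra.Bundles using (AbelianGroup; CommutativeMonoid; CommutativeRing)
open import Algebra.Module.Bundles using (Module)
open import Axiom.ExcludedMiddle using (ExcludedMiddle)
open import Data.Bool.Base using (true; false; if_then_else_)
open import Data.Fin.Base as Fin
  using (Fin; zero; suc; punchIn; punchOut; _↑ˡ_; _↑ʳ_; combine; remQuot)
open import Data.Fin.Properties using (_≟_; punchIn-punchOut; remQuot-combine; ∀-cons)
open import Data.List.Base as List using (List; []; _∷_; length)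
open import Data.List.Properties using (tabulate-lookup)
open import Data.List.Relation.Unary.All as All using (All; []; _∷_)
open import Data.List.Relation.Unary.AllPairs using (AllPairs; []; _∷_)
open import Data.List.Relation.Unary.Any as Any using (Any; here)
open import Data.Nat.Base as ℕ using (ℕ; zero; suc; s≤s)
open import Data.Product.Base using (Σ; _×_; _,_; proj₁; proj₂)
open import Data.Sum.Base using (_⊎_; inj₁; inj₂; [_,_]′)
open import Data.Vec.Functional as Vec using (_++_)
open import Data.Vec.Functional.Properties using (lookup-++ˡ; lookup-++ʳ)
open import Function.Base using (_∘_; id)
open import Function.Bundles using (_⇔_; mk⇔; Equivalence)
open import Level using (Level; _⊔_; Lift; lift; lower) renaming (suc to lsuc)
open import Relation.Binary.PropositionalEquality as ≡ using (_≡_)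
open import Relation.Nullary.Decidable using (Dec; does; yes; no)
open import Relation.Nullary.Negation using (¬_; contradiction)
import Algebra.Properties.AbelianGroup as AbelianGroupProperties
import Algebra.Properties.CommutativeMonoid.Sum as CommutativeMonoidSum
import Algebra.Properties.CommutativeSemigroup as CommutativeSemigroupProperties
import Algebra.Solver.Ring.NaturalCoefficients.Default as NaturalSolver
import Data.List.Relation.Unary.All.Properties as All
import Data.List.Relation.Unary.Any.Properties as Any
import Function.Properties.Equivalence as ⇔
import Relation.Binary.Reasoning.Setoid as SetoidReasoning

-- The default `o` is a parameter so that one multiple of a unit vector serves for ring elements,
-- module elements and uniform scalars.
only : ∀ {a} {A : Set a} {n} → A → Fin n → A → Fin n → A
only o i x j = if does (i ≟ j) then x else o

-- Linear systems over a commutative ring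

module LinearSystems {c ℓ} (R : CommutativeRing c ℓ) {m ℓm} (N : Module R m ℓm) where
  open CommutativeRing R hiding (zero)
  open Module N
  open CommutativeMonoidSum +ᴹ-commutativeMonoid public using (sum)
  open CommutativeMonoidSum +ᴹ-commutativeMonoid
    using (sum-cong-≋; ∑-distrib-+; sum-replicate-zero)
  open AbelianGroupProperties +ᴹ-abelianGroup using (inverseʳ-unique)
  open SetoidReasoning ≈ᴹ-setoid

  private variable
    n k l : ℕ

  move : ∀ x y z → x ≈ᴹ y +ᴹ z → x +ᴹ -ᴹ y ≈ᴹ z
  move x y z eq = begin
    x +ᴹ -ᴹ y         ≈⟨ +ᴹ-congʳ (≈ᴹ-trans eq (+ᴹ-comm y z)) ⟩
    z +ᴹ y +ᴹ -ᴹ y    ≈⟨ +ᴹ-assoc z y (-ᴹ y) ⟩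
    z +ᴹ (y +ᴹ -ᴹ y)  ≈⟨ +ᴹ-congˡ (-ᴹ‿inverseʳ y) ⟩
    z +ᴹ 0ᴹ           ≈⟨ +ᴹ-identityʳ z ⟩
    z                 ∎

  unmove : ∀ x y z → x +ᴹ -ᴹ y ≈ᴹ z → x ≈ᴹ z +ᴹ y
  unmove x y z eq = begin
    x                    ≈⟨ +ᴹ-identityʳ x ⟨
    x +ᴹ 0ᴹ              ≈⟨ +ᴹ-congˡ (-ᴹ‿inverseˡ y) ⟨
    x +ᴹ (-ᴹ y +ᴹ y)     ≈⟨ +ᴹ-assoc x (-ᴹ y) y ⟨
    x +ᴹ -ᴹ y +ᴹ y       ≈⟨ +ᴹ-congʳ eq ⟩
    z +ᴹ y               ∎

  lin : (Fin n → Carrier) → (Fin n → Carrierᴹ) → Carrierᴹ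
  lin a x = sum (λ j → x j *ᵣ a j)

  lin-cong : ∀ {a b : Fin n → Carrier} {x y : Fin n → Carrierᴹ} →
             (∀ j → a j ≈ b j) → (∀ j → x j ≈ᴹ y j) → lin a x ≈ᴹ lin b y
  lin-cong a≈b x≈y = sum-cong-≋ (λ j → *ᵣ-cong (x≈y j) (a≈b j))

  lin-zero : (x : Fin n → Carrierᴹ) → lin (λ _ → 0#) x ≈ᴹ 0ᴹ
  lin-zero {n} x = ≈ᴹ-trans (sum-cong-≋ (*ᵣ-zeroʳ ∘ x)) (sum-replicate-zero n)

  lin-+ : (a b : Fin n → Carrier) (x : Fin n → Carrierᴹ) →
          lin (λ j → a j + b j) x ≈ᴹ lin a x +ᴹ lin b x
  lin-+ a b x = ≈ᴹ-trans (sum-cong-≋ (λ j → *ᵣ-distribˡ (x j) (a j) (b j)))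
    (∑-distrib-+ (λ j → x j *ᵣ a j) (λ j → x j *ᵣ b j))

  lin-+ᴹ : (a : Fin n → Carrier) (x y : Fin n → Carrierᴹ) →
           lin a (λ j → x j +ᴹ y j) ≈ᴹ lin a x +ᴹ lin a y
  lin-+ᴹ a x y = ≈ᴹ-trans (sum-cong-≋ (λ j → *ᵣ-distribʳ (a j) (x j) (y j)))
    (∑-distrib-+ (λ j → x j *ᵣ a j) (λ j → y j *ᵣ a j))

  lin-scale : (a : Fin n → Carrier) (r : Carrier) (x : Fin n → Carrierᴹ) →
              lin (λ j → a j * r) x ≈ᴹ lin a x *ᵣ r
  lin-scale {zero}  a r x = ≈ᴹ-sym (*ᵣ-zeroˡ r)
  lin-scale {suc n} a r x = ≈ᴹ-trans
    (+ᴹ-cong (≈ᴹ-sym (*ᵣ-assoc _ _ r)) (lin-scale (a ∘ suc) r (x ∘ suc)))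
    (≈ᴹ-sym (*ᵣ-distribʳ r _ _))

  lin-neg : (a : Fin n → Carrier) (x : Fin n → Carrierᴹ) →
            lin (λ j → - a j) x ≈ᴹ -ᴹ lin a x
  lin-neg a x = inverseʳ-unique (lin a x) (lin (λ j → - a j) x) (begin
    lin a x +ᴹ lin (λ j → - a j) x  ≈⟨ lin-+ a (λ j → - a j) x ⟨
    lin (λ j → a j + - a j) x       ≈⟨ lin-cong (λ j → -‿inverseʳ (a j)) (λ _ → ≈ᴹ-refl) ⟩
    lin (λ _ → 0#) x                ≈⟨ lin-zero x ⟩
    0ᴹ                              ∎)

  sum-at : (i : Fin n) (u : Fin n → Carrierᴹ) → sum (λ j → only 0ᴹ i (u j) j) ≈ᴹ u i
  sum-at {suc n} zero    u = ≈ᴹ-trans (+ᴹ-congˡ (sum-replicate-zero n)) (+ᴹ-identityʳ _)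
  sum-at {suc n} (suc i) u = ≈ᴹ-trans (+ᴹ-identityˡ _) (sum-at i (u ∘ suc))

  lin-at : (i : Fin n) (r : Carrier) (x : Fin n → Carrierᴹ) →
           lin (only 0# i r) x ≈ᴹ x i *ᵣ r
  lin-at i r x = ≈ᴹ-trans (sum-cong-≋ pointwise) (sum-at i (λ j → x j *ᵣ r))
    where
    pointwise : ∀ j → x j *ᵣ only 0# i r j ≈ᴹ only 0ᴹ i (x j *ᵣ r) j
    pointwise j with does (i ≟ j)
    ... | true  = ≈ᴹ-refl
    ... | false = *ᵣ-zeroʳ (x j)

  lin-atᴹ : (i : Fin n) (y : Carrierᴹ) (a : Fin n → Carrier) →
            lin a (only 0ᴹ i y) ≈ᴹ y *ᵣ a i
  lin-atᴹ i y a = ≈ᴹ-trans (sum-cong-≋ pointwise) (sum-at i (λ j → y *ᵣ a j))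
    where
    pointwise : ∀ j → only 0ᴹ i y j *ᵣ a j ≈ᴹ only 0ᴹ i (y *ᵣ a j) j
    pointwise j with does (i ≟ j)
    ... | true  = ≈ᴹ-refl
    ... | false = *ᵣ-zeroˡ (a j)

  sum-split : ∀ k (u : Fin (k ℕ.+ l) → Carrierᴹ) →
              sum u ≈ᴹ sum (u ∘ (_↑ˡ l)) +ᴹ sum (u ∘ (k ↑ʳ_))
  sum-split zero    u = ≈ᴹ-sym (+ᴹ-identityˡ _)
  sum-split (suc k) u = ≈ᴹ-trans (+ᴹ-congˡ (sum-split k (u ∘ suc))) (≈ᴹ-sym (+ᴹ-assoc _ _ _))

  Solvable : (Fin k → Fin l → Carrier) → (Fin k → Fin n → Carrier) →
             (Fin n → Carrierᴹ) → Set (m ⊔ ℓm)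
  Solvable A B z = Σ (Fin _ → Carrierᴹ) λ x → ∀ i → lin (B i) z ≈ᴹ lin (A i) x

  -- For nonzero d this is V_d(b·z), for d = 0 the equation b·z = 0. One shape for both keeps
  -- elimination free of that distinction.
  Holds : (Fin n → Carrier) → Carrier → (Fin n → Carrierᴹ) → Set (m ⊔ ℓm)
  Holds b d z = Σ Carrierᴹ λ y → lin b z ≈ᴹ y *ᵣ d

  -- Subtracts from each remaining row the multiple of row p that kills its entry in the pivot
  -- column. The column stays, filled with zeros, so only the number of rows drops.
  clear : (Fin (suc k) → Carrier) → Fin (suc k) →
          (Fin (suc k) → Fin n → Carrier) → Fin k → Fin n → Carrier
  clear r p A i j = A (punchIn p i) j + - (A p j * r (punchIn p i))

  lin-clear : ∀ r p (A : Fin (suc k) → Fin n → Carrier) i x →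
              lin (clear r p A i) x ≈ᴹ lin (A (punchIn p i)) x +ᴹ -ᴹ (lin (A p) x *ᵣ r (punchIn p i))
  lin-clear r p A i x = ≈ᴹ-trans (lin-+ _ _ x)
    (+ᴹ-congˡ (≈ᴹ-trans (lin-neg _ x) (-ᴹ‿cong (lin-scale (A p) _ x))))

  -- Row p of A is A p q times s, so solving it makes B p · z a multiple of the pivot. The cleared
  -- rows vanish in column q and leave x q free to adjust row p.
  pivot : ∀ (A : Fin (suc k) → Fin l → Carrier) (B : Fin (suc k) → Fin n → Carrier) p q
            (r : Fin (suc k) → Carrier) (s : Fin l → Carrier) →
          (∀ i → A p q * r i ≈ A i q) → (∀ j → A p q * s j ≈ A p j) → ∀ z →
          Solvable A B z ⇔ (Holds (B p) (A p q) z × Solvable (clear r p A) (clear r p B) z)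
  pivot {l = l} A B p q r s rA sA z = mk⇔ to from
    where
    to : Solvable A B z → Holds (B p) (A p q) z × Solvable (clear r p A) (clear r p B) z
    to (x , eq) = (lin s x , ≈ᴹ-trans (eq p) rowp) , x , λ i → begin
        lin (clear r p B i) z  ≈⟨ lin-clear r p B i z ⟩
        lin (B (punchIn p i)) z +ᴹ -ᴹ (lin (B p) z *ᵣ r (punchIn p i))
          ≈⟨ +ᴹ-cong (eq _) (-ᴹ‿cong (*ᵣ-congʳ (eq p))) ⟩
        lin (A (punchIn p i)) x +ᴹ -ᴹ (lin (A p) x *ᵣ r (punchIn p i))
          ≈⟨ lin-clear r p A i x ⟨
        lin (clear r p A i) x ∎
      where
      rowp : lin (A p) x ≈ᴹ lin s x *ᵣ A p q
      rowp = ≈ᴹ-trans (lin-cong (λ j → trans (sym (sA j)) (*-comm _ _)) (λ _ → ≈ᴹ-refl))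
                      (lin-scale s (A p q) x)
    from : Holds (B p) (A p q) z × Solvable (clear r p A) (clear r p B) z → Solvable A B z
    from ((y , eqp) , x , eq) = x′ , solves
      where
      -- Changing x in coordinate q does not affect the cleared rows, and can be used
      -- to make row p hold.
      w : Carrierᴹ
      w = y +ᴹ -ᴹ lin s x
      x′ : Fin l → Carrierᴹ
      x′ j = x j +ᴹ only 0ᴹ q w j
      row : ∀ i → lin (A i) x′ ≈ᴹ lin (A i) x +ᴹ w *ᵣ A i q
      row i = ≈ᴹ-trans (lin-+ᴹ (A i) x _) (+ᴹ-congˡ (lin-atᴹ q w (A i)))
      rowp : lin (B p) z ≈ᴹ lin (A p) x′
      rowp = begin
        lin (B p) z                                   ≈⟨ eqp ⟩
        y *ᵣ A p q                                    ≈⟨ *ᵣ-congʳ (unmove y (lin s x) w ≈ᴹ-refl) ⟩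
        (w +ᴹ lin s x) *ᵣ A p q                       ≈⟨ *ᵣ-congʳ (+ᴹ-comm _ _) ⟩
        (lin s x +ᴹ w) *ᵣ A p q                       ≈⟨ *ᵣ-distribʳ _ _ _ ⟩
        lin s x *ᵣ A p q +ᴹ w *ᵣ A p q                ≈⟨ +ᴹ-congʳ (lin-scale s (A p q) x) ⟨
        lin (λ j → s j * A p q) x +ᴹ w *ᵣ A p q
          ≈⟨ +ᴹ-congʳ (lin-cong (λ j → trans (*-comm _ _) (sA j)) (λ _ → ≈ᴹ-refl)) ⟩
        lin (A p) x +ᴹ w *ᵣ A p q                     ≈⟨ row p ⟨
        lin (A p) x′                                  ∎
      other : ∀ i → lin (B (punchIn p i)) z ≈ᴹ lin (A (punchIn p i)) x′
      -- Multiplication by r i′ carries the change w A p q of row p to w A i′ q, which is the change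
      -- of row i′ itself.
      other i = begin
        lin (B i′) z
          ≈⟨ unmove _ _ _ (≈ᴹ-trans (≈ᴹ-sym (lin-clear r p B i z))
                          (≈ᴹ-trans (eq i) (lin-clear r p A i x))) ⟩
        lin (A i′) x +ᴹ -ᴹ (lin (A p) x *ᵣ r i′) +ᴹ lin (B p) z *ᵣ r i′
          ≈⟨ +ᴹ-congˡ (*ᵣ-congʳ (≈ᴹ-trans rowp (row p))) ⟩
        lin (A i′) x +ᴹ -ᴹ (lin (A p) x *ᵣ r i′) +ᴹ (lin (A p) x +ᴹ w *ᵣ A p q) *ᵣ r i′
          ≈⟨ +ᴹ-congˡ (*ᵣ-distribʳ _ _ _) ⟩
        lin (A i′) x +ᴹ -ᴹ (lin (A p) x *ᵣ r i′) +ᴹ (lin (A p) x *ᵣ r i′ +ᴹ w *ᵣ A p q *ᵣ r i′)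
          ≈⟨ +ᴹ-assoc _ _ _ ⟨
        lin (A i′) x +ᴹ -ᴹ (lin (A p) x *ᵣ r i′) +ᴹ lin (A p) x *ᵣ r i′ +ᴹ w *ᵣ A p q *ᵣ r i′
          ≈⟨ +ᴹ-cong (≈ᴹ-sym (unmove _ _ _ ≈ᴹ-refl)) (≈ᴹ-trans (*ᵣ-assoc _ _ _) (*ᵣ-congˡ (rA i′))) ⟩
        lin (A i′) x +ᴹ w *ᵣ A i′ q  ≈⟨ row i′ ⟨
        lin (A i′) x′  ∎
        where i′ = punchIn p i
      solves : ∀ i → lin (B i) z ≈ᴹ lin (A i) x′
      solves i with p ≟ i
      ... | yes ≡.refl = rowp
      ... | no p≢i = ≡.subst (λ h → lin (B h) z ≈ᴹ lin (A h) x′) (punchIn-punchOut p≢i)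
                             (other (punchOut p≢i))

-- Properties of lists, read entry by entry.

module _ {a p} {A : Set a} {P : A → Set p} where

  all⇒lookup : ∀ {xs} → All P xs → ∀ i → P (List.lookup xs i)
  all⇒lookup {xs} all = All.tabulate⁻ (≡.subst (All P) (≡.sym (tabulate-lookup xs)) all)

  lookup⇒all : ∀ {xs} → (∀ i → P (List.lookup xs i)) → All P xs
  lookup⇒all {xs} h = ≡.subst (All P) (tabulate-lookup xs) (All.tabulate⁺ h)

allPairs⇒lookup : ∀ {a r} {A : Set a} {R : A → A → Set r} {xs} → AllPairs R xs →
                  ∀ {i j} → i Fin.< j → R (List.lookup xs i) (List.lookup xs j)
allPairs⇒lookup (x ∷ _)  {zero}  {suc j} _         = all⇒lookup x j
allPairs⇒lookup (_ ∷ xs) {suc i} {suc j} (s≤s i<j) = allPairs⇒lookup xs i<j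

-- Normal forms over a domain with total divisibility

module Divisors {c ℓ} (D : IntegralDomain c ℓ) where
  open IntegralDomain D

  infix 4 _∣_
  _∣_ : Carrier → Carrier → Set (c ⊔ ℓ)
  x ∣ y = Σ Carrier λ r → x * r ≈ y

module NormalForms {c ℓ} (D : IntegralDomain c ℓ)
  (zero? : ∀ x → Dec (IntegralDomain._≈_ D x (IntegralDomain.0# D)))
  (_∣?_  : ∀ x y → Dec (Divisors._∣_ D x y))
  (total : ∀ x y → Divisors._∣_ D x y ⊎ Divisors._∣_ D y x)
  where
  open IntegralDomain D hiding (zero)
  open Divisors D
  open FractionField D using (num; den)
  open Divisibility D
  open NaturalSolver commutativeSemiring using (solve; _:=_; _:*_)

  private variable
    x y z x′ y′ : Carrier

  ∣-resp : x ≈ x′ → y ≈ y′ → x ∣ y → x′ ∣ y′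
  ∣-resp x≈ y≈ (r , xr≈y) = r , trans (*-congʳ (sym x≈)) (trans xr≈y y≈)

  ∣-trans : x ∣ y → y ∣ z → x ∣ z
  ∣-trans (r , xr≈y) (s , ys≈z) = r * s , trans (sym (*-assoc _ r s)) (trans (*-congʳ xr≈y) ys≈z)

  ∣-cancelʳ : z ≉ 0# → (x * z) ∣ (y * z) → x ∣ y
  ∣-cancelʳ {z} {x} {y} z≉0 (r , eq) = r , *-cancelʳ-nonzero D (x * r) y z≉0
    (trans (solve 3 (λ x r z → (x :* r) :* z := (x :* z) :* r) refl x r z) eq)

  ∤⇒∣ : ¬ x ∣ y → y ∣ x
  ∤⇒∣ {x} {y} x∤y with total x y
  ... | inj₁ x∣y with () ← x∤y x∣y
  ... | inj₂ y∣x = y∣x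

  -- Totality turns the failed divisibility into γ ≤ δ. If the classes were equal, the inverse of
  -- the unit δγ⁻¹ would restore the excluded divisibility.
  <Γ-intro : ∀ γ δ → ¬ (num (proj₁ δ) * den (proj₁ γ)) ∣ (num (proj₁ γ) * den (proj₁ δ)) → γ <Γ δ
  <Γ-intro (γ , _) (δ , _) δ∤γ = le , λ (u , (u′ , u′u≈1 , _) , u≈) → δ∤γ (u′ , (begin
    (num δ * den γ) * u′                   ≈⟨ *-congʳ (*-identityʳ _) ⟨
    ((num δ * den γ) * 1#) * u′            ≈⟨ *-congʳ u≈ ⟨
    (u * (den δ * num γ)) * u′
      ≈⟨ solve 4 (λ u d n u′ → (u :* (d :* n)) :* u′ := (u′ :* u) :* (n :* d)) refl u (den δ) (num γ) u′ ⟩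
    (u′ * u) * (num γ * den δ)             ≈⟨ *-congʳ u′u≈1 ⟩
    1# * (num γ * den δ)                   ≈⟨ *-identityˡ _ ⟩
    num γ * den δ                          ∎))
    where
    open SetoidReasoning setoid
    le : Σ Carrier λ r → r * (den δ * num γ) ≈ (num δ * den γ) * 1#
    le = let r , eq = ∤⇒∣ δ∤γ in r , (begin
      r * (den δ * num γ)    ≈⟨ solve 3 (λ r d n → r :* (d :* n) := (n :* d) :* r) refl r (den δ) (num γ) ⟩
      (num γ * den δ) * r    ≈⟨ eq ⟩
      num δ * den γ          ≈⟨ *-identityʳ _ ⟨
      (num δ * den γ) * 1#   ∎)

  -- The condition V_{v(d)}(z.b).

  record Entry : Set (c ⊔ ℓ) where
    field
      b d : Carrier
      b≉0 : b ≉ 0#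
      d≉0 : d ≉ 0#

  open Entry

  -- v(b e) ≤ v(b f), respectively v(d e)/v(b e) ≤ v(d f)/v(b f).

  _≤ᵇ_ _≤ˢ_ : Entry → Entry → Set (c ⊔ ℓ)
  e ≤ᵇ f = b e ∣ b f
  e ≤ˢ f = (d e * b f) ∣ (d f * b e)

  ≤ˢ-trans : ∀ e f g → e ≤ˢ f → f ≤ˢ g → e ≤ˢ g
  ≤ˢ-trans e f g e≤f f≤g = ∣-cancelʳ (b≉0 f) (∣-trans
    (∣-resp (swap (d e) (b f) (b g)) refl (∣-*ʳ (b g) e≤f))
    (∣-resp (swap (d f) (b g) (b e)) (swap (d g) (b f) (b e)) (∣-*ʳ (b e) f≤g)))
    where
    swap : ∀ x y z → (x * y) * z ≈ (x * z) * y
    swap = solve 3 (λ x y z → (x :* y) :* z := (x :* z) :* y) refl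
    ∣-*ʳ : ∀ {x y} z → x ∣ y → (x * z) ∣ (y * z)
    ∣-*ʳ {x} z (r , xr≈y) = r , trans (swap x z r) (*-congʳ xr≈y)

  -- The two strict inequalities of the normal form, kept in the negative form that the decisions
  -- return and `<Γ-intro` expects.
  Above : Entry → Entry → Set (c ⊔ ℓ)
  Above e f = (¬ e ≤ᵇ f) × (¬ e ≤ˢ f)

  above-trans : ∀ e f g → Above e f → Above f g → Above e g
  above-trans e f g (e≰ᵇf , e≰ˢf) (f≰ᵇg , f≰ˢg) =
    (λ e≤g → e≰ᵇf (∣-trans e≤g (∤⇒∣ f≰ᵇg))) , (λ e≤g → e≰ˢf (≤ˢ-trans e g f e≤g (∤⇒∣ f≰ˢg)))

  Stronger : Entry → Entry → Set (c ⊔ ℓ)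
  Stronger e f = e ≤ᵇ f × f ≤ˢ e

  data Comparison (e f : Entry) : Set (c ⊔ ℓ) where
    stronger : Stronger e f → Comparison e f
    weaker   : Stronger f e → Comparison e f
    above    : Above e f → Comparison e f
    below    : Above f e → Comparison e f

  -- Both preorders are total. If they disagree or one of them ties, one condition implies the
  -- other; otherwise one entry is strictly larger in both.
  compareEntries : ∀ e f → Comparison e f
  compareEntries e f with b e ∣? b f | (d f * b e) ∣? (d e * b f)
                        | b f ∣? b e | (d e * b f) ∣? (d f * b e)
  ... | yes e≤ᵇf | yes f≤ˢe | _        | _        = stronger (e≤ᵇf , f≤ˢe)
  ... | _        | _        | yes f≤ᵇe | yes e≤ˢf = weaker (f≤ᵇe , e≤ˢf)
  ... | no e≰ᵇf  | _        | _        | no e≰ˢf  = above (e≰ᵇf , e≰ˢf)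
  ... | _        | no f≰ˢe  | no f≰ᵇe  | _        = below (f≰ᵇe , f≰ˢe)
  -- The last two clauses are impossible, since each preorder holds in at least one direction.
  ... | no e≰ᵇf  | _        | no f≰ᵇe  | _        = contradiction (∤⇒∣ e≰ᵇf) f≰ᵇe
  ... | _        | no f≰ˢe  | _        | no e≰ˢf  = contradiction (∤⇒∣ f≰ˢe) e≰ˢf

  module _ (m ℓm : Level) where

    infix 4 _⊩_∈_∙_
    _⊩_∈_∙_ : (N : Module commutativeRing m ℓm) → Carrier → Carrier → Module.Carrierᴹ N → Set (m ⊔ ℓm)
    N ⊩ b ∈ d ∙ z = Σ Carrierᴹ λ y → z *ᵣ b ≈ᴹ y *ᵣ d
      where open Module N

    Satisfies : (N : Module commutativeRing m ℓm) → Module.Carrierᴹ N → Entry → Set (m ⊔ ℓm)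
    Satisfies N z e = N ⊩ b e ∈ d e ∙ z

    -- With b f = b e r, the second inequality says that d f divides d e r once b e is cancelled;
    -- hence z.b f = y.d e r is a multiple of d f.
    stronger-sound : ∀ {e f} → Stronger e f → ∀ N z → Satisfies N z e → Satisfies N z f
    stronger-sound {e} {f} ((r , be*r≈bf) , (s , eq)) N z (y , zb≈yd) = y *ᵣ s , (begin
      z *ᵣ b f            ≈⟨ *ᵣ-congˡ be*r≈bf ⟨
      z *ᵣ (b e * r)      ≈⟨ *ᵣ-assoc z (b e) r ⟨
      z *ᵣ b e *ᵣ r       ≈⟨ *ᵣ-congʳ zb≈yd ⟩
      y *ᵣ d e *ᵣ r       ≈⟨ *ᵣ-assoc y (d e) r ⟩
      y *ᵣ (d e * r)      ≈⟨ *ᵣ-congˡ cancelled ⟨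
      y *ᵣ (s * d f)      ≈⟨ *ᵣ-assoc y s (d f) ⟨
      y *ᵣ s *ᵣ d f       ∎)
      where
      open Module N
      open SetoidReasoning ≈ᴹ-setoid
      cancelled : s * d f ≈ d e * r
      cancelled = *-cancelʳ-nonzero D (s * d f) (d e * r) (b≉0 e)
        (trans (solve 3 (λ s d b → (s :* d) :* b := (d :* b) :* s) refl s (d f) (b e))
        (trans eq (trans (*-congˡ (sym be*r≈bf))
          (solve 3 (λ d b r → d :* (b :* r) := (d :* r) :* b) refl (d e) (b e) r))))

    Chain : Set (c ⊔ ℓ)
    Chain = Σ (List Entry) (AllPairs Above)

    -- The middle component is the invariant needed to put a larger entry in front.

    insert : ∀ e L → AllPairs Above L → Σ Chain λ (L′ , _) →
             (∀ g → Above g e → All (Above g) L → All (Above g) L′) ×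
             (∀ N z → (Satisfies N z e × All (Satisfies N z) L) ⇔ All (Satisfies N z) L′)
    insert e [] [] = (e ∷ [] , [] ∷ []) , (λ _ g>e _ → g>e ∷ []) ,
      λ N z → mk⇔ (λ (s , _) → s ∷ []) (λ { (s ∷ _) → s , [] })
    insert e (f ∷ L) (f>L ∷ L↓) with compareEntries e f
    -- f becomes redundant and is dropped; e may make later entries redundant too, so insertion goes
    -- on.
    ... | stronger e⇒f =
      let L′ , bound , sat = insert e L L↓ in
      L′ , (λ { g g>e (_ ∷ g>L) → bound g g>e g>L }) , λ N z → mk⇔
        (λ { (s , _ ∷ ss) → Equivalence.to (sat N z) (s , ss) })
        (λ ss′ → let s , ss = Equivalence.from (sat N z) ss′ in
                 s , stronger-sound {e} {f} e⇒f N z s ∷ ss)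
    ... | weaker f⇒e = (f ∷ L , f>L ∷ L↓) , (λ _ _ g>fL → g>fL) , λ N z → mk⇔
        proj₂ (λ { (s ∷ ss) → stronger-sound {f} {e} f⇒e N z s , s ∷ ss })
    -- Transitivity places e above everything after f as well.
    ... | above e>f =
      (e ∷ f ∷ L , (e>f ∷ All.map (λ {g} → above-trans e f g e>f) f>L) ∷ f>L ∷ L↓) ,
      (λ _ g>e g>fL → g>e ∷ g>fL) , λ N z → mk⇔ (λ (s , ss) → s ∷ ss) (λ { (s ∷ ss) → s , ss })
    ... | below f>e =
      let (L′ , L′↓) , bound , sat = insert e L L↓ in
      (f ∷ L′ , bound f f>e f>L ∷ L′↓) , (λ { g g>e (g>f ∷ g>L) → g>f ∷ bound g g>e g>L }) ,
      λ N z → mk⇔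
        (λ { (s , t ∷ ts) → t ∷ Equivalence.to (sat N z) (s , ts) })
        (λ { (t ∷ ts) → let s , ss = Equivalence.from (sat N z) ts in s , t ∷ ss })

    Annihilates : (N : Module commutativeRing m ℓm) → Module.Carrierᴹ N → Carrier → Set ℓm
    Annihilates N z a = z *ᵣ a ≈ᴹ 0ᴹ where open Module N

    annihilates-∣ : ∀ {x y} → x ∣ y → ∀ N z → Annihilates N z x → Annihilates N z y
    annihilates-∣ {x} (r , xr≈y) N z zx≈0 =
      ≈ᴹ-trans (*ᵣ-congˡ (sym xr≈y)) (≈ᴹ-trans (≈ᴹ-sym (*ᵣ-assoc z x r))
        (≈ᴹ-trans (*ᵣ-congʳ zx≈0) (*ᵣ-zeroˡ r)))
      where open Module N

    -- Of two elements one divides the other, and annihilation by the divisor implies annihilation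
    -- by the multiple.
    annihilator : ∀ x y → Σ Carrier λ a → ∀ N z →
                  (Annihilates N z x × Annihilates N z y) ⇔ Annihilates N z a
    annihilator x y with total x y
    ... | inj₁ x∣y = x , λ N z → mk⇔ proj₁ (λ zx → zx , annihilates-∣ x∣y N z zx)
    ... | inj₂ y∣x = y , λ N z → mk⇔ proj₂ (λ zy → annihilates-∣ y∣x N z zy , zy)

    normalise : (cs : List (Carrier × Carrier)) → Σ (Carrier × Chain) λ (a , L , _) →
                ∀ N z → All (λ (b , d) → N ⊩ b ∈ d ∙ z) cs ⇔ (Annihilates N z a × All (Satisfies N z) L)
    -- Every element is annihilated by 0, so 0 is the neutral start for the equation.
    normalise [] = (0# , [] , []) , λ N z → mk⇔ (λ _ → Module.*ᵣ-zeroʳ N z , []) (λ _ → [])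
    normalise ((b , d) ∷ cs) with normalise cs | zero? d | zero? b
    -- With d = 0 the condition is the equation z.b = 0, which is merged with z.a = 0.
    ... | (a , L) , sat | yes d≈0 | _ = let a′ , sat′ = annihilator b a in
      (a′ , L) , λ N z → let open Module N in mk⇔
        (λ { ((y , zb≈yd) ∷ ss) → let za≈0 , ts = Equivalence.to (sat N z) ss in
             Equivalence.to (sat′ N z)
               (≈ᴹ-trans zb≈yd (≈ᴹ-trans (*ᵣ-congˡ d≈0) (*ᵣ-zeroʳ y)) , za≈0) , ts })
        (λ (za′≈0 , ts) → let zb≈0 , za≈0 = Equivalence.from (sat′ N z) za′≈0 in
             (0ᴹ , ≈ᴹ-trans zb≈0 (≈ᴹ-sym (*ᵣ-zeroˡ d))) ∷ Equivalence.from (sat N z) (za≈0 , ts))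
    -- With b = 0 the condition always holds and is dropped, as the normal form demands nonzero b.
    ... | aL , sat | no _ | yes b≈0 = aL , λ N z → let open Module N in mk⇔
        (λ { (_ ∷ ss) → Equivalence.to (sat N z) ss })
        (λ ts → (0ᴹ , ≈ᴹ-trans (*ᵣ-congˡ b≈0) (≈ᴹ-trans (*ᵣ-zeroʳ z) (≈ᴹ-sym (*ᵣ-zeroˡ d)))) ∷
                Equivalence.from (sat N z) ts)
    ... | (a , L , L↓) , sat | no d≉0 | no b≉0 =
      let L′ , _ , sat′ = insert (record { b = b ; d = d ; b≉0 = b≉0 ; d≉0 = d≉0 }) L L↓ in
      (a , L′) , λ N z → mk⇔
        (λ { (s ∷ ss) → let za≈0 , ts = Equivalence.to (sat N z) ss in
             za≈0 , Equivalence.to (sat′ N z) (s , ts) })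
        (λ (za≈0 , ts′) → let s , ts = Equivalence.from (sat′ N z) ts′ in
             s ∷ Equivalence.from (sat N z) (za≈0 , ts))

    normalForm : Carrier → Chain → NormalForm D
    normalForm a (L , L↓) = record
      { a   = a
      ; n   = length L
      ; b   = b ∘ List.lookup L
      ; b≉0 = λ i → b≉0 (List.lookup L i)
      ; δ   = δ ∘ List.lookup L
      ; δ/vb-decreasing = λ {i} {j} i<j → let e = List.lookup L i ; f = List.lookup L j in
          <Γ-intro (proj₁ (δ f) · (vb f ⁻¹)) (proj₁ (δ e) · (vb e ⁻¹))
            (proj₂ (allPairs⇒lookup L↓ i<j) ∘ ∣-resp (unit (d e) (b f)) (unit (d f) (b e)))
      ; vb-decreasing = λ {i} {j} i<j → let e = List.lookup L i ; f = List.lookup L j in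
          <Γ-intro (vb f) (vb e)
            (proj₁ (allPairs⇒lookup L↓ i<j) ∘ ∣-resp (*-identityʳ (b e)) (*-identityʳ (b f)))
      }
      where
      vb : Entry → ∣Γ∣
      vb e = v (b e) (b≉0 e)
      δ : Entry → Γ⁺
      -- Choosing d e itself as the generator makes V_δ mean divisibility by d e by definition.
      δ e = v (d e) (d≉0 e) , d e , d≉0 e , AbelianGroup.refl Γ {v (d e) (d≉0 e)}
      unit : ∀ x y → (x * 1#) * (1# * y) ≈ x * y
      unit x y = *-cong (*-identityʳ x) (*-identityˡ y)

    normalForm⇔ : ∀ a ((L , L↓) : Chain) N (z : Fin 1 → Module.Carrierᴹ N) →
                  (Annihilates N (z zero) a × All (Satisfies N (z zero)) L) ⇔
                  Semantics._⊨_[_] D N (NormalForm.formula (normalForm a (L , L↓))) z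
    normalForm⇔ a (L , L↓) N z = mk⇔
      (λ (za≈0 , ss) → lift za≈0 ∷ All.tabulate⁺ (all⇒lookup ss))
      (λ { (lift za≈0 ∷ ss) → za≈0 , lookup⇒all (All.tabulate⁻ ss) })

    toNormalForm : (cs : List (Carrier × Carrier)) → Σ (NormalForm D) λ ψ →
                   ∀ N (z : Fin 1 → Module.Carrierᴹ N) →
                   All (λ (b , d) → N ⊩ b ∈ d ∙ z zero) cs ⇔ Semantics._⊨_[_] D N (NormalForm.formula ψ) z
    toNormalForm cs = let (a , L) , sat = normalise cs in
      normalForm a L , λ N z → ⇔.trans (sat N (z zero)) (normalForm⇔ a L N z)

-- Elimination uniformly in M

module _ {c ℓ} (B : BézoutDomain c ℓ) where
  open BézoutDomain B hiding (zero)
  open NaturalSolver commutativeSemiring using (solve; _:=_; _:*_; _:+_)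
  open SetoidReasoning setoid

  -- The Bézout relation is stated for the cofactors: it prevents x′ and y′ from lying in the same
  -- maximal ideal.
  record GCD (x y : Carrier) : Set (c ⊔ ℓ) where
    field
      d x′ y′ r s : Carrier
      x≈   : x ≈ x′ * d
      y≈   : y ≈ y′ * d
      rx+sy≈1 : r * x′ + s * y′ ≈ 1#

  ⟨_,_⟩ : Carrier → Carrier → Ideal commutativeRing (c ⊔ ℓ)
  ⟨ x , y ⟩ = record
    { Member   = λ w → Σ Carrier λ r → Σ Carrier λ s → w ≈ r * x + s * y
    ; resp     = λ v≈w (r , s , v≈) → r , s , trans (sym v≈w) v≈
    ; 0∈       = 0# , 0# , sym (trans (+-cong (zeroˡ x) (zeroˡ y)) (+-identityˡ 0#))
    ; +-closed = λ (r , s , v≈) (r′ , s′ , w≈) → r + r′ , s + s′ , trans (+-cong v≈ w≈)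
        (solve 6 (λ r s r′ s′ x y → (r :* x :+ s :* y) :+ (r′ :* x :+ s′ :* y) :=
                                    (r :+ r′) :* x :+ (s :+ s′) :* y) refl r s r′ s′ x y)
    ; absorb   = λ t (r , s , w≈) → t * r , t * s , trans (*-congˡ w≈)
        (solve 5 (λ t r s x y → t :* (r :* x :+ s :* y) :=
                                (t :* r) :* x :+ (t :* s) :* y) refl t r s x y)
    }

  -- A generator d of the ideal (x, y) is a combination rx + sy. As x is nonzero, so is d, and
  -- cancelling d gives the relation between the cofactors.
  gcd : ∀ x y → x ≉ 0# → GCD x y
  gcd x y x≉0 = record
    { d = d ; x′ = x′ ; y′ = y′ ; r = r ; s = s ; x≈ = x≈ ; y≈ = y≈
    ; rx+sy≈1 = *-cancelʳ-nonzero integralDomain _ _ d≉0 (begin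
        (r * x′ + s * y′) * d
          ≈⟨ solve 5 (λ r x s y d → (r :* x :+ s :* y) :* d := r :* (x :* d) :+ s :* (y :* d))
               refl r x′ s y′ d ⟩
        r * (x′ * d) + s * (y′ * d)  ≈⟨ +-cong (*-congˡ x≈) (*-congˡ y≈) ⟨
        r * x + s * y                ≈⟨ d≈ ⟨
        d                            ≈⟨ *-identityˡ d ⟨
        1# * d                       ∎)
    }
    where
    generators : Fin 2 → Carrier
    generators zero    = x
    generators (suc _) = y
    principal : IsPrincipal commutativeRing ⟨ x , y ⟩
    principal = bézout ⟨ x , y ⟩ (2 , generators , λ w → mk⇔
      (λ (r , s , w≈) → (λ { zero → r ; (suc _) → s }) ,
                        trans w≈ (+-congˡ (sym (+-identityʳ _))))
      (λ (t , w≈) → t zero , t (suc zero) , trans w≈ (+-congˡ (+-identityʳ _))))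
    d : Carrier
    d = proj₁ principal
    divides : ∀ {w} → Ideal.Member ⟨ x , y ⟩ w → Σ Carrier λ t → w ≈ t * d
    divides {w} = Equivalence.to (proj₂ principal w)
    x∈ : Σ Carrier λ t → x ≈ t * d
    x∈ = divides (1# , 0# , sym (trans (+-cong (*-identityˡ x) (zeroˡ y)) (+-identityʳ x)))
    y∈ : Σ Carrier λ t → y ≈ t * d
    y∈ = divides (0# , 1# , sym (trans (+-cong (zeroˡ x) (*-identityˡ y)) (+-identityˡ y)))
    d∈ : Ideal.Member ⟨ x , y ⟩ d
    d∈ = Equivalence.from (proj₂ principal d) (1# , sym (*-identityˡ d))
    x′ y′ r s : Carrier
    x′ = proj₁ x∈
    y′ = proj₁ y∈
    r = proj₁ d∈
    s = proj₁ (proj₂ d∈)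
    x≈ : x ≈ x′ * d
    x≈ = proj₂ x∈
    y≈ : y ≈ y′ * d
    y≈ = proj₂ y∈
    d≈ : d ≈ r * x + s * y
    d≈ = proj₂ (proj₂ d∈)
    d≉0 : d ≉ 0#
    d≉0 d≈0 = x≉0 (trans x≈ (trans (*-congˡ d≈0) (zeroʳ x′)))

module Uniform {c ℓ} (em : ExcludedMiddle (c ⊔ ℓ)) (B : BézoutDomain c ℓ) where
  open BézoutDomain B hiding (zero)
  open AtMaximal integralDomain
  open Divisibility integralDomain using (Γ⁺)
  open NaturalSolver commutativeSemiring using (solve; _:=_; _:*_)
  module Q = FractionField integralDomain
  module QR = IntegralDomain Q.localization
  module L (M : MSpec) = Localize integralDomain (complement M)
  module LR (M : MSpec) = IntegralDomain (atM M)

  -- Finite case distinctions over constructible subsets, and uniform scalars.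

  Subset : Set c
  Subset = Constructible commutativeRing

  private variable
    C D E : Subset
    p q : Level
    k l n : ℕ
    X : Set

  infix 4 _⊆_
  -- A record, because membership computes away and C and D could not be inferred from a bare
  -- function.
  record _⊆_ (C D : Subset) : Set (lsuc (c ⊔ ℓ)) where
    constructor subset
    field include : ∀ M → M ∈ C → M ∈ D

  open _⊆_

  ⊆-refl : C ⊆ C
  ⊆-refl = subset λ _ → id

  ⊆-trans : C ⊆ D → D ⊆ E → C ⊆ E
  ⊆-trans C⊆D D⊆E = subset λ M → include D⊆E M ∘ include C⊆D M

  -- A finite decision tree whose branchings ask whether a lies in M. The sets reached at the leaves
  -- are constructible, and each leaf carries data valid on its set.
  data Cases (P : Subset → Set p) (C : Subset) : Set (c ⊔ p) where
    leaf  : P C → Cases P C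
    split : ∀ a → Cases P (C ∩ V a) → Cases P (C ∩ ∁ (V a)) → Cases P C

  -- Grafts further trees onto the leaves. The inclusion passed on lets data given over C be
  -- restricted to a leaf.
  bind : {P : Subset → Set p} {P′ : Subset → Set q} →
         Cases P C → (∀ {D} → D ⊆ C → P D → Cases P′ D) → Cases P′ C
  bind (leaf x)      f = f ⊆-refl x
  bind (split a l r) f = split a (bind l (λ D⊆ → f (⊆-trans D⊆ (subset λ _ → proj₁))))
                                 (bind r (λ D⊆ → f (⊆-trans D⊆ (subset λ _ → proj₁))))

  zero? : ∀ x → Dec (x ≈ 0#)
  zero? x with em {Lift c (x ≈ 0#)}
  ... | yes x≈0 = yes (lower x≈0)
  ... | no  x≉0 = no (x≉0 ∘ lift)

  -- UniformScalar C, as a record so that C can be inferred from a scalar.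
  record Scalar (C : Subset) : Set (lsuc (c ⊔ ℓ)) where
    constructor scalar
    field
      value  : Q.Fraction
      liesIn : ∀ M → M ∈ C → LiesIn M value

  open Scalar

  ⟦_⟧ : Scalar C → ∀ M → M ∈ C → L.Fraction M
  ⟦ x ⟧ M M∈C = proj₁ (liesIn x M M∈C)

  restrict : D ⊆ C → Scalar C → Scalar D
  restrict D⊆C x = scalar (value x) λ M → liesIn x M ∘ include D⊆C M

  ιᵘ : Carrier → Scalar C
  ιᵘ a = scalar (Q.ι a) λ M _ → L.ι M a , refl

  infixl 6 _+ᵘ_
  infixl 7 _*ᵘ_
  infix  8 -ᵘ_

  -- Fractions in B_M and in Q(B) are added and multiplied by the same formulas, so congruence in
  -- Q(B) is all that the membership proofs need.
  _+ᵘ_ _*ᵘ_ : Scalar C → Scalar C → Scalar C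
  scalar x x∈ +ᵘ scalar y y∈ = scalar (x Q.⊕ y) λ M M∈ →
    let x′ , x′≃x = x∈ M M∈ ; y′ , y′≃y = y∈ M M∈ in
    L._⊕_ M x′ y′ , QR.+-cong {atM⊆Q M x′} {x} {atM⊆Q M y′} {y} x′≃x y′≃y
  scalar x x∈ *ᵘ scalar y y∈ = scalar (x Q.⊗ y) λ M M∈ →
    let x′ , x′≃x = x∈ M M∈ ; y′ , y′≃y = y∈ M M∈ in
    L._⊗_ M x′ y′ , QR.*-cong {atM⊆Q M x′} {x} {atM⊆Q M y′} {y} x′≃x y′≃y

  -ᵘ_ : Scalar C → Scalar C
  -ᵘ scalar x x∈ = scalar (Q.⊖ x) λ M M∈ →
    let x′ , x′≃x = x∈ M M∈ in
    L.⊖_ M x′ , QR.-‿cong {atM⊆Q M x′} {x} x′≃x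

  -- A single quotient in Q(B) has to lie in B_M for every M in D at once.
  record Divides (D : Subset) (x y : Q.Fraction) : Set (lsuc (c ⊔ ℓ)) where
    constructor dividing
    field
      quot  : Scalar D
      quot≃ : (x Q.⊗ value quot) Q.≃ y

  open Divides

  divides-refl : ∀ {x} → Divides D x x
  divides-refl {x = x} = dividing (ιᵘ 1#) (QR.*-identityʳ x)

  divides-trans : ∀ {x y z} → Divides D x y → Divides D y z → Divides D x z
  divides-trans {x = x} {y} {z} (dividing r xr≃y) (dividing s ys≃z) = dividing (r *ᵘ s)
    (QR.trans {x Q.⊗ (value r Q.⊗ value s)} {(x Q.⊗ value r) Q.⊗ value s} {z}
      (QR.sym {(x Q.⊗ value r) Q.⊗ value s} {x Q.⊗ (value r Q.⊗ value s)}
        (QR.*-assoc x (value r) (value s)))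
      (QR.trans {(x Q.⊗ value r) Q.⊗ value s} {y Q.⊗ value s} {z}
        (QR.*-congʳ {value s} {x Q.⊗ value r} {y} xr≃y) ys≃z))

  divides-restrict : ∀ {x y} → D ⊆ C → Divides C x y → Divides D x y
  divides-restrict D⊆C (dividing r xr≃y) = dividing (restrict D⊆C r) xr≃y

  -- B_M embeds in Q(B), so the equation may be checked there, where the quotient was found.
  ⟦⟧-divides : ∀ (a b : Scalar C) (a∣b : Divides C (value a) (value b)) M (M∈C : M ∈ C) →
               L._≃_ M (L._⊗_ M (⟦ a ⟧ M M∈C) (⟦ quot a∣b ⟧ M M∈C)) (⟦ b ⟧ M M∈C)
  ⟦⟧-divides (scalar x x∈) (scalar y y∈) (dividing (scalar r r∈) xr≃y) M M∈C =
    let x′ , x′≃x = x∈ M M∈C ; y′ , y′≃y = y∈ M M∈C ; r′ , r′≃r = r∈ M M∈C in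
    QR.trans {atM⊆Q M x′ Q.⊗ atM⊆Q M r′} {x Q.⊗ r} {atM⊆Q M y′}
      (QR.*-cong {atM⊆Q M x′} {x} {atM⊆Q M r′} {r} x′≃x r′≃r)
      (QR.trans {x Q.⊗ r} {y} {atM⊆Q M y′} xr≃y (QR.sym {atM⊆Q M y′} {y} y′≃y))

  -- The cross-multiplied form of (p/s)(y/x) = u/t, where x and y are the cofactors of pt and us
  -- with respect to d.
  cross-ratio : ∀ {p s u t x y d} → p * t ≈ x * d → u * s ≈ y * d → (p * y) * t ≈ u * (s * x)
  cross-ratio {p} {s} {u} {t} {x} {y} {d} pt≈xd us≈yd = begin
    (p * y) * t  ≈⟨ solve 3 (λ p y t → (p :* y) :* t := (p :* t) :* y) refl p y t ⟩
    (p * t) * y  ≈⟨ *-congʳ pt≈xd ⟩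
    (x * d) * y  ≈⟨ solve 3 (λ x d y → (x :* d) :* y := (y :* d) :* x) refl x d y ⟩
    (y * d) * x  ≈⟨ *-congʳ us≈yd ⟨
    (u * s) * x  ≈⟨ *-assoc u s x ⟩
    u * (s * x)  ∎
    where open SetoidReasoning setoid

  coprime∉ : ∀ (M : MSpec) {r x s y} → r * x + s * y ≈ 1# →
             MaximalIdeal.Member M x → ¬ MaximalIdeal.Member M y
  coprime∉ M {r} {x} {s} {y} 1≈ x∈ y∈ =
    MaximalIdeal.proper M (resp 1≈ (+-closed (absorb r x∈) (absorb s y∈)))
    where open MaximalIdeal M

  quotient : ∀ y {x} → x ≉ 0# → (∀ M → M ∈ C → ¬ MaximalIdeal.Member M x) → Scalar C
  quotient y {x} x≉0 x∉ = scalar (y Q./ x ⟨ x≉0 ⟩) λ M M∈C →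
    record { num = y ; den = x ; den∈S = x∉ M M∈C } , refl

  divides-zero : ∀ x y → Q.num y ≈ 0# → Divides C x y
  divides-zero (p Q./ s ⟨ _ ⟩) (u Q./ t ⟨ _ ⟩) u≈0 = dividing (ιᵘ 0#) (begin
    (p * 0#) * t   ≈⟨ *-congʳ (zeroʳ p) ⟩
    0# * t         ≈⟨ zeroˡ t ⟩
    0#             ≈⟨ zeroˡ _ ⟨
    0# * (s * 1#)  ≈⟨ *-congʳ u≈0 ⟨
    u * (s * 1#)   ∎)
    where open SetoidReasoning setoid

  -- A common denominator reduces the comparison to elements of B, and the gcd reduces it to the
  -- cofactors. Zero is treated apart, because both cofactors must serve as denominators.
  compare : ∀ x y → Cases (λ D → Divides D x y ⊎ Divides D y x) C
  compare x y with zero? (Q.num x) | zero? (Q.num y)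
  ... | yes x≈0 | _ = leaf (inj₂ (divides-zero y x x≈0))
  ... | no _ | yes y≈0 = leaf (inj₁ (divides-zero x y y≈0))
  ... | no p≉0 | no u≉0 = split x′
    (leaf (inj₂ (dividing
      (quotient x′ y′≉0 (λ M M∈ → coprime∉ M {r} {x′} {s} {y′} rx+sy≈1 (proj₂ M∈)))
      (cross-ratio y≈ x≈))))
    (leaf (inj₁ (dividing (quotient y′ x′≉0 (λ M M∈ → proj₂ M∈)) (cross-ratio x≈ y≈))))
    where
    open GCD (gcd B (Q.num x * Q.den y) (Q.num y * Q.den x)
                  (nonzero-* integralDomain p≉0 (Q.den∈S y)))
    x′≉0 : x′ ≉ 0#
    x′≉0 x′≈0 = nonzero-* integralDomain p≉0 (Q.den∈S y) (trans x≈ (trans (*-congʳ x′≈0) (zeroˡ d)))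
    y′≉0 : y′ ≉ 0#
    y′≉0 y′≈0 = nonzero-* integralDomain u≉0 (Q.den∈S x) (trans y≈ (trans (*-congʳ y′≈0) (zeroˡ d)))

  minimum : (f : Fin (suc n) → Q.Fraction) →
            Cases (λ D → Σ (Fin (suc n)) λ k → ∀ i → Divides D (f k) (f i)) C
  minimum {zero}  f = leaf (zero , λ { zero → divides-refl })
  minimum {suc n} f = bind (minimum (f ∘ suc)) λ _ (k , k∣) →
    bind (compare (f zero) (f (suc k))) λ
    { D⊆ (inj₁ 0∣k) → leaf (zero , ∀-cons divides-refl
        (λ i → divides-trans 0∣k (divides-restrict D⊆ (k∣ i))))
    ; D⊆ (inj₂ k∣0) → leaf (suc k , ∀-cons k∣0 (λ i → divides-restrict D⊆ (k∣ i))) }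

  -- The matrix is read as one family of (k+1)(l+1) fractions, so that `minimum` applies.
  pivotEntry : (A : Fin (suc k) → Fin (suc l) → Q.Fraction) →
               Cases (λ D → Σ (Fin (suc k)) λ p → Σ (Fin (suc l)) λ q →
                            ∀ i j → Divides D (A p q) (A i j)) C
  pivotEntry {k} {l} A = bind (minimum entry) λ {D = D} _ (e , e∣) →
    leaf (proj₁ (remQuot {suc k} (suc l) e) , proj₂ (remQuot {suc k} (suc l) e) , λ i j →
      ≡.subst (λ (i , j) → Divides D (entry e) (A i j)) (remQuot-combine i j) (e∣ (combine i j)))
    where
    entry : Fin (suc k ℕ.* suc l) → Q.Fraction
    entry e = let p , q = remQuot {suc k} (suc l) e in A p q

  -- The data of `Holds`, separated from its meaning in order not to depend on M or on a module.
  Condition : Subset → ℕ → Set (lsuc (c ⊔ ℓ))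
  Condition D n = (Fin n → Scalar D) × Scalar D

  -- Elimination of the unknowns.

  module _ {m ℓm : Level} where
    module Lin (M : MSpec) (N : Module (LR.commutativeRing M) m ℓm) =
      LinearSystems (LR.commutativeRing M) N

    SolvableAt : (Fin k → Fin l → Scalar C) → (Fin k → Fin n → Scalar C) →
                 ∀ M → M ∈ C → (N : Module (LR.commutativeRing M) m ℓm) →
                 (Fin n → Module.Carrierᴹ N) → Set (m ⊔ ℓm)
    SolvableAt A B M M∈C N =
      Lin.Solvable M N (λ i j → ⟦ A i j ⟧ M M∈C) (λ i j → ⟦ B i j ⟧ M M∈C)

    HoldsAt : ∀ M → M ∈ C → (N : Module (LR.commutativeRing M) m ℓm) →
              (Fin n → Module.Carrierᴹ N) → Condition C n → Set (m ⊔ ℓm)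
    HoldsAt M M∈C N z (b , d) = Lin.Holds M N (λ j → ⟦ b j ⟧ M M∈C) (⟦ d ⟧ M M∈C) z

    -- The conditions are chosen before M and N: the same list serves every M in D and every module.
    SystemSolved : (Fin k → Fin l → Scalar C) → (Fin k → Fin n → Scalar C) →
             Subset → Set (lsuc (c ⊔ ℓ ⊔ m ⊔ ℓm))
    SystemSolved {C = C} {n = n} A B D = Σ (D ⊆ C) λ D⊆C → Σ (List (Condition D n)) λ cs →
      ∀ M (M∈D : M ∈ D) N z → SolvableAt A B M (include D⊆C M M∈D) N z ⇔ All (HoldsAt M M∈D N z) cs

    clearᵘ : (Fin (suc k) → Scalar C) → Fin (suc k) →
             (Fin (suc k) → Fin n → Scalar C) → Fin k → Fin n → Scalar C
    clearᵘ r p A i j = A (punchIn p i) j +ᵘ -ᵘ (A p j *ᵘ r (punchIn p i))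

    -- Induction on the number of rows. Each pivot step removes one row and contributes one
    -- condition.
    eliminate : (A : Fin k → Fin l → Scalar C) (B : Fin k → Fin n → Scalar C) →
                Cases (SystemSolved A B) C
    eliminate {zero} A B = leaf (⊆-refl , [] , λ M _ N z →
      mk⇔ (λ _ → []) (λ _ → (λ _ → Module.0ᴹ N) , λ ()))
    -- Without unknowns every row is an equation b·z = 0, encoded with d = 0.
    eliminate {suc k} {zero} {n = n} A B =
      leaf (⊆-refl , List.tabulate equation , λ M M∈D N z →
      let open Module N in mk⇔
      (λ (x , eq) → All.tabulate⁺ {f = equation} (λ i → 0ᴹ , ≈ᴹ-trans (eq i) (≈ᴹ-sym (*ᵣ-zeroʳ 0ᴹ))))
      (λ hs → (λ ()) , λ i →
        let y , eq = All.tabulate⁻ {P = HoldsAt M M∈D N z} {f = equation} hs i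
        in ≈ᴹ-trans eq (*ᵣ-zeroʳ y)))
      where
      equation : Fin (suc k) → Condition _ n
      equation i = B i , ιᵘ 0#
    eliminate {suc k} {suc l} {C} {n} A B = bind (pivotEntry (λ i j → value (A i j)))
      λ {D = D} D⊆C (p , q , pivot∣) →
        let A′ : Fin (suc k) → Fin (suc l) → Scalar D
            A′ i j = restrict D⊆C (A i j)
            B′ : Fin (suc k) → Fin n → Scalar D
            B′ i j = restrict D⊆C (B i j)
            r : Fin (suc k) → Scalar D
            r i = quot (pivot∣ i q)
        in bind (eliminate (clearᵘ r p A′) (clearᵘ r p B′)) λ {E} _ (E⊆D , cs , solved) →
        leaf (⊆-trans E⊆D D⊆C ,
              ((λ j → restrict E⊆D (B′ p j)) , restrict E⊆D (A′ p q)) ∷ cs ,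
              λ M M∈E N z →
                let M∈D = include E⊆D M M∈E
                    step = Lin.pivot M N (λ i j → ⟦ A′ i j ⟧ M M∈D) (λ i j → ⟦ B′ i j ⟧ M M∈D) p q
                             (λ i → ⟦ r i ⟧ M M∈D) (λ j → ⟦ quot (pivot∣ p j) ⟧ M M∈D)
                             (λ i → ⟦⟧-divides (A′ p q) (A′ i q) (pivot∣ i q) M M∈D)
                             (λ j → ⟦⟧-divides (A′ p q) (A′ p j) (pivot∣ p j) M M∈D) z
                    rest = solved M M∈E N z
                in mk⇔ (λ s → let h , s′ = Equivalence.to step s in h ∷ Equivalence.to rest s′)
                       (λ { (h ∷ hs) → Equivalence.from step (h , Equivalence.from rest hs) }))

  -- Reduction of pp formulas to linear systems.

  linearPart : (X → Fin l → Scalar C) → Term Carrier Γ⁺ X → Fin l → Scalar C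
  linearPart e (var x) j = e x j
  linearPart e 𝟎       j = ιᵘ 0#
  linearPart e (t ⊞ u) j = linearPart e t j +ᵘ linearPart e u j
  linearPart e (⊟ t)   j = -ᵘ linearPart e t j
  linearPart e (t ∙ r) j = linearPart e t j *ᵘ ιᵘ r

  variable-coefficient : Fin l → Fin l → Scalar C
  variable-coefficient i = only (ιᵘ 0#) i (ιᵘ 1#)

  boundPart : Term Carrier Γ⁺ (Fin k ⊎ Fin n) → Fin k → Scalar C
  boundPart = linearPart [ variable-coefficient , (λ _ _ → ιᵘ 0#) ]′

  freePart : Term Carrier Γ⁺ (Fin k ⊎ Fin n) → Fin n → Scalar C
  freePart = linearPart [ (λ _ _ → ιᵘ 0#) , variable-coefficient ]′

  -- The atom α asserts that body α is a multiple of modulus α.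

  body : Atomic Carrier Γ⁺ X → Term Carrier Γ⁺ X
  body (t ≐ u) = t ⊞ ⊟ u
  body (V _ t) = t

  modulus : Atomic Carrier Γ⁺ X → Scalar C
  modulus (_ ≐ _)           = ιᵘ 0#
  modulus (V (_ , a , _) _) = ιᵘ a

  module _ (θ : Conjunction Carrier Γ⁺ (Fin k ⊎ Fin n)) where

    atom : Fin (length θ) → Atomic Carrier Γ⁺ (Fin k ⊎ Fin n)
    atom = List.lookup θ

    -- One additional unknown per atom, the quotient of its body by its modulus.

    unknowns : Fin (length θ) → Fin (k ℕ.+ length θ) → Scalar C
    unknowns i = (λ j → -ᵘ boundPart (body (atom i)) j) ++ only (ιᵘ 0#) i (modulus (atom i))

    parameters : Fin (length θ) → Fin n → Scalar C
    parameters i = freePart (body (atom i))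

  module _ {m ℓm : Level} (M : MSpec) (M∈C : M ∈ C) (N : Module (LR.commutativeRing M) m ℓm) where
    private
      module R = LR M
    open Module N
    open Lin M N
    open Semantics (atM M) using (eval; _⊨ᵃ_[_]; _⊨ᵖ_[_])
    open AbelianGroupProperties +ᴹ-abelianGroup using (⁻¹-∙-comm; x∙y⁻¹≈ε⇒x≈y; x≈y⇒x∙y⁻¹≈ε)
    open CommutativeSemigroupProperties
      (CommutativeMonoid.commutativeSemigroup +ᴹ-commutativeMonoid) using (interchange)
    open SetoidReasoning ≈ᴹ-setoid

    value-of : (Fin l → Scalar C) → (Fin l → Carrierᴹ) → Carrierᴹ
    value-of a = lin (λ j → ⟦ a j ⟧ M M∈C)

    value-at : (i : Fin l) (r : Scalar C) (x : Fin l → Carrierᴹ) →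
               value-of (only (ιᵘ 0#) i r) x ≈ᴹ x i *ᵣ ⟦ r ⟧ M M∈C
    value-at i r x = ≈ᴹ-trans (lin-cong pointwise (λ _ → ≈ᴹ-refl)) (lin-at i (⟦ r ⟧ M M∈C) x)
      where
      pointwise : ∀ j → ⟦ only (ιᵘ 0#) i r j ⟧ M M∈C R.≈ only R.0# i (⟦ r ⟧ M M∈C) j
      pointwise j with does (i ≟ j)
      ... | true  = R.refl {⟦ r ⟧ M M∈C}
      ... | false = R.refl {R.0#}

    value-variable : (i : Fin l) (x : Fin l → Carrierᴹ) → value-of (variable-coefficient i) x ≈ᴹ x i
    value-variable i x = ≈ᴹ-trans (value-at i (ιᵘ 1#) x) (*ᵣ-identityʳ (x i))

    translate : ∀ {X} → Term Carrier Γ⁺ X → Term R.Carrier (Divisibility.Γ⁺ (atM M)) X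
    translate = mapTerm (toAtM M) (imageΓ⁺ M)

    eval-parts : (x : Fin k → Carrierᴹ) (z : Fin n → Carrierᴹ) (t : Term Carrier Γ⁺ (Fin k ⊎ Fin n)) →
                 eval N [ x , z ]′ (translate t) ≈ᴹ value-of (boundPart t) x +ᴹ value-of (freePart t) z
    eval-parts x z (var (inj₁ i)) = ≈ᴹ-sym (≈ᴹ-trans
      (+ᴹ-cong (value-variable i x) (lin-zero z)) (+ᴹ-identityʳ (x i)))
    eval-parts x z (var (inj₂ i)) = ≈ᴹ-sym (≈ᴹ-trans
      (+ᴹ-cong (lin-zero x) (value-variable i z)) (+ᴹ-identityˡ (z i)))
    eval-parts x z 𝟎 = ≈ᴹ-sym (≈ᴹ-trans (+ᴹ-cong (lin-zero x) (lin-zero z)) (+ᴹ-identityˡ 0ᴹ))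
    eval-parts x z (t ⊞ u) = begin
      eval N _ (translate t) +ᴹ eval N _ (translate u)
        ≈⟨ +ᴹ-cong (eval-parts x z t) (eval-parts x z u) ⟩
      (value-of (boundPart t) x +ᴹ value-of (freePart t) z) +ᴹ
      (value-of (boundPart u) x +ᴹ value-of (freePart u) z)
        ≈⟨ interchange _ _ _ _ ⟩
      (value-of (boundPart t) x +ᴹ value-of (boundPart u) x) +ᴹ
      (value-of (freePart t) z +ᴹ value-of (freePart u) z)
        ≈⟨ +ᴹ-cong (lin-+ _ _ x) (lin-+ _ _ z) ⟨
      value-of (boundPart (t ⊞ u)) x +ᴹ value-of (freePart (t ⊞ u)) z ∎
    eval-parts x z (⊟ t) = begin
      -ᴹ eval N _ (translate t)                                      ≈⟨ -ᴹ‿cong (eval-parts x z t) ⟩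
      -ᴹ (value-of (boundPart t) x +ᴹ value-of (freePart t) z)       ≈⟨ ⁻¹-∙-comm _ _ ⟨
      -ᴹ value-of (boundPart t) x +ᴹ -ᴹ value-of (freePart t) z      ≈⟨ +ᴹ-cong (lin-neg _ x) (lin-neg _ z) ⟨
      value-of (boundPart (⊟ t)) x +ᴹ value-of (freePart (⊟ t)) z    ∎
    eval-parts x z (t ∙ r) = begin
      eval N _ (translate t) *ᵣ toAtM M r                                  ≈⟨ *ᵣ-congʳ (eval-parts x z t) ⟩
      (value-of (boundPart t) x +ᴹ value-of (freePart t) z) *ᵣ toAtM M r   ≈⟨ *ᵣ-distribʳ _ _ _ ⟩
      value-of (boundPart t) x *ᵣ toAtM M r +ᴹ value-of (freePart t) z *ᵣ toAtM M r
        ≈⟨ +ᴹ-cong (lin-scale _ _ x) (lin-scale _ _ z) ⟨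
      value-of (boundPart (t ∙ r)) x +ᴹ value-of (freePart (t ∙ r)) z      ∎

    atom⇔multiple : ∀ {X} (α : Atomic Carrier Γ⁺ X) ρ →
                    _⊨ᵃ_[_] N (mapAtomic (toAtM M) (imageΓ⁺ M) α) ρ ⇔
                    Σ Carrierᴹ λ y → eval N ρ (translate (body α)) ≈ᴹ y *ᵣ ⟦ modulus {C = C} α ⟧ M M∈C
    atom⇔multiple (t ≐ u) ρ = mk⇔
      (λ (lift eq) → 0ᴹ , ≈ᴹ-trans (x≈y⇒x∙y⁻¹≈ε eq) (≈ᴹ-sym (*ᵣ-zeroʳ 0ᴹ)))
      (λ (y , eq) → lift (x∙y⁻¹≈ε⇒x≈y _ _ (≈ᴹ-trans eq (*ᵣ-zeroʳ y))))
    -- The translation sends the chosen generator a of δ to a/1, which is also the modulus, so both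
    -- sides coincide.
    atom⇔multiple (V _ t) ρ = mk⇔ id id

    module _ (θ : Conjunction Carrier Γ⁺ (Fin k ⊎ Fin n)) (z : Fin n → Carrierᴹ) where

      row : ∀ i (x : Fin (k ℕ.+ length θ) → Carrierᴹ) →
            value-of (unknowns θ i) x ≈ᴹ
            -ᴹ value-of (boundPart (body (atom θ i))) (x ∘ (_↑ˡ length θ)) +ᴹ
            x (k ↑ʳ i) *ᵣ ⟦ modulus {C = C} (atom θ i) ⟧ M M∈C
      row i x = ≈ᴹ-trans (sum-split k _) (+ᴹ-cong
        (≈ᴹ-trans (lin-cong (λ j → reflexive′ (lookup-++ˡ bound modulusAt j)) (λ _ → ≈ᴹ-refl))
                  (lin-neg _ (x ∘ (_↑ˡ length θ))))
        (≈ᴹ-trans (lin-cong (λ j → reflexive′ (lookup-++ʳ bound modulusAt j)) (λ _ → ≈ᴹ-refl))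
                  (value-at i (modulus (atom θ i)) (x ∘ (k ↑ʳ_)))))
        where
        bound : Fin k → Scalar C
        bound j = -ᵘ boundPart (body (atom θ i)) j
        modulusAt : Fin (length θ) → Scalar C
        modulusAt = only (ιᵘ 0#) i (modulus (atom θ i))
        reflexive′ : ∀ {a b : Scalar C} → a ≡ b → ⟦ a ⟧ M M∈C R.≈ ⟦ b ⟧ M M∈C
        reflexive′ {a} ≡.refl = R.refl {⟦ a ⟧ M M∈C}

      -- Each atom says that its bound part plus its free part is y times its modulus. Moving the
      -- bound part across gives one row, with y as the extra unknown.
      pp⇔solvable : _⊨ᵖ_[_] N (mapPP (toAtM M) (imageΓ⁺ M) (∃⟨ k ⟩ θ)) z ⇔
                    SolvableAt {C = C} (unknowns θ) (parameters θ) M M∈C N z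
      pp⇔solvable = mk⇔ to from
        where
        to : _⊨ᵖ_[_] N (mapPP (toAtM M) (imageΓ⁺ M) (∃⟨ k ⟩ θ)) z →
             SolvableAt {C = C} (unknowns θ) (parameters θ) M M∈C N z
        to (x , all) = x ++ proj₁ ∘ y , λ i → begin
          value-of (parameters θ i) z
            ≈⟨ move _ (value-of (boundPart (body (atom θ i))) x) _
                 (≈ᴹ-trans (≈ᴹ-sym (proj₂ (y i))) (eval-parts x z (body (atom θ i)))) ⟨
          proj₁ (y i) *ᵣ ⟦ modulus {C = C} (atom θ i) ⟧ M M∈C +ᴹ -ᴹ value-of (boundPart (body (atom θ i))) x
            ≈⟨ +ᴹ-comm _ _ ⟩
          -ᴹ value-of (boundPart (body (atom θ i))) x +ᴹ proj₁ (y i) *ᵣ ⟦ modulus {C = C} (atom θ i) ⟧ M M∈C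
            ≈⟨ +ᴹ-cong (-ᴹ‿cong (lin-cong
                  (λ j → R.refl {⟦ boundPart (body (atom θ i)) j ⟧ M M∈C})
                  (λ j → ≈ᴹ-reflexive (lookup-++ˡ x (proj₁ ∘ y) j))))
                 (*ᵣ-congʳ (≈ᴹ-reflexive (lookup-++ʳ x (proj₁ ∘ y) i))) ⟨
          -ᴹ value-of (boundPart (body (atom θ i))) ((x ++ proj₁ ∘ y) ∘ (_↑ˡ length θ)) +ᴹ
          (x ++ proj₁ ∘ y) (k ↑ʳ i) *ᵣ ⟦ modulus {C = C} (atom θ i) ⟧ M M∈C
            ≈⟨ row i (x ++ proj₁ ∘ y) ⟨
          value-of (unknowns θ i) (x ++ proj₁ ∘ y) ∎
          where
          y : ∀ i → Σ Carrierᴹ λ y → eval N [ x , z ]′ (translate (body (atom θ i))) ≈ᴹ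
                                     y *ᵣ ⟦ modulus {C = C} (atom θ i) ⟧ M M∈C
          y i = Equivalence.to (atom⇔multiple (atom θ i) [ x , z ]′) (all⇒lookup (All.map⁻ all) i)
        from : SolvableAt {C = C} (unknowns θ) (parameters θ) M M∈C N z →
               _⊨ᵖ_[_] N (mapPP (toAtM M) (imageΓ⁺ M) (∃⟨ k ⟩ θ)) z
        from (x , eq) = x ∘ (_↑ˡ length θ) , All.map⁺ (lookup⇒all λ i →
          let p = value-of (boundPart (body (atom θ i))) (x ∘ (_↑ˡ length θ))
              w = value-of (parameters θ i) z
          in Equivalence.from (atom⇔multiple (atom θ i) [ x ∘ (_↑ˡ length θ) , z ]′)
            (x (k ↑ʳ i) , ≈ᴹ-trans (eval-parts (x ∘ (_↑ˡ length θ)) z (body (atom θ i)))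
              (≈ᴹ-trans (+ᴹ-comm p w) (≈ᴹ-sym (unmove _ p w
                (≈ᴹ-trans (+ᴹ-comm _ _) (≈ᴹ-sym (≈ᴹ-trans (eq i) (row i x)))))))))

  FormulaSolved : ∀ m ℓm → PPFormula integralDomain n → Subset → Set (lsuc (c ⊔ ℓ ⊔ m ⊔ ℓm))
  FormulaSolved {n} m ℓm φ D = Σ (List (Condition D n)) λ cs →
    ∀ M (M∈D : M ∈ D) (N : Module (LR.commutativeRing M) m ℓm) z →
    Semantics._⊨ᵖ_[_] (atM M) N (φ at M) z ⇔ All (HoldsAt M M∈D N z) cs

  -- The tree is rooted at V(0), which is all of MSpec because every ideal contains 0.
  solved : ∀ {m ℓm} (φ : PPFormula integralDomain n) → Cases (FormulaSolved m ℓm φ) (V 0#)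
  solved (∃⟨ k ⟩ θ) = bind (eliminate (unknowns θ) (parameters θ)) λ _ (D⊆ , cs , eqv) →
    leaf (cs , λ M M∈D N z →
      let pp = pp⇔solvable M (_⊆_.include D⊆ M M∈D) N θ z ; sol = eqv M M∈D N z in
      mk⇔ (Equivalence.to sol ∘ Equivalence.to pp) (Equivalence.from pp ∘ Equivalence.from sol))

  -- From trees and conditions back to constructible covers and formulas.

  leaves : {P : Subset → Set p} → Cases P C → List (Σ Subset P)
  leaves {C = C} (leaf x) = (C , x) ∷ []
  leaves (split _ l r)   = leaves l List.++ leaves r

  leaves-cover : {P : Subset → Set p} (t : Cases P C) → ∀ M → M ∈ C → Any (λ (D , _) → M ∈ D) (leaves t)
  leaves-cover (leaf _)      M M∈C = here M∈C
  -- Excluded middle decides at each branching which way M goes.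
  leaves-cover (split a l r) M M∈C with em {MaximalIdeal.Member M a}
  ... | yes a∈M = Any.++⁺ˡ (leaves-cover l M (M∈C , a∈M))
  ... | no  a∉M = Any.++⁺ʳ (leaves l) (leaves-cover r M (M∈C , a∉M))

  toUniform : Scalar C → UniformScalar C
  toUniform x = value x , liesIn x

  linearTerm : (Fin n → Scalar C) → Term (UniformScalar C) (UniformPred C) (Fin n)
  linearTerm b = Vec.foldr _⊞_ 𝟎 (λ j → var j ∙ toUniform (b j))

  -- The class of d may fail to be positive in Γ(B). Over B_M it is the value of `⟦ d ⟧ M M∈C`, and
  -- the unit relating the two representatives is 1.
  predicate : (d : Scalar C) → Q.num (value d) ≉ 0# → UniformPred C
  predicate d d≉0 = (value d , d≉0 ∘ Q.≃0⇒num≈0 (value d)) , λ M M∈C →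
    ⟦ d ⟧ M M∈C , nonzero M M∈C ,
    (L.ι M 1# , (L.ι M 1# , LR.*-identityˡ M (L.ι M 1#) , LR.*-identityˡ M (L.ι M 1#)) ,
     equal M M∈C)
    where
    nonzero : ∀ M M∈C → ¬ L._≃_ M (⟦ d ⟧ M M∈C) (L.ι M 0#)
    nonzero M M∈C ⟦d⟧≃0 = d≉0 (Q.≃0⇒num≈0 (value d)
      (QR.trans {value d} {atM⊆Q M (⟦ d ⟧ M M∈C)} {Q.ι 0#}
        (QR.sym {atM⊆Q M (⟦ d ⟧ M M∈C)} {value d} (proj₂ (liesIn d M M∈C))) ⟦d⟧≃0))
    equal : ∀ M M∈C →
            let x = ⟦ d ⟧ M M∈C in
            (1# * (1# * Q.num (value d))) * ((L.den {M} x * 1#) * 1#) ≈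
            ((L.num {M} x * Q.den (value d)) * 1#) * (1# * (1# * 1#))
    equal M M∈C = let x = ⟦ d ⟧ M M∈C in begin
      (1# * (1# * Q.num (value d))) * ((L.den {M} x * 1#) * 1#)
        ≈⟨ *-cong (trans (*-identityˡ _) (*-identityˡ _)) (trans (*-identityʳ _) (*-identityʳ _)) ⟩
      Q.num (value d) * L.den {M} x
        ≈⟨ proj₂ (liesIn d M M∈C) ⟨
      L.num {M} x * Q.den (value d)
        ≈⟨ *-identityʳ _ ⟨
      (L.num {M} x * Q.den (value d)) * 1#
        ≈⟨ *-identityʳ _ ⟨
      ((L.num {M} x * Q.den (value d)) * 1#) * 1#
        ≈⟨ *-congˡ (trans (*-identityˡ _) (*-identityˡ _)) ⟨
      ((L.num {M} x * Q.den (value d)) * 1#) * (1# * (1# * 1#)) ∎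
      where open SetoidReasoning setoid

  -- V_δ exists only for nonzero d, so d = 0 yields an equation. The decision is an argument so that
  -- the proof of correctness can match on it.
  conditionAtom : (Fin n → Scalar C) → (d : Scalar C) → Dec (Q.num (value d) ≈ 0#) →
                  Atomic (UniformScalar C) (UniformPred C) (Fin n)
  conditionAtom b d (yes _)  = linearTerm b ≐ 𝟎
  conditionAtom b d (no d≉0) = V (predicate d d≉0) (linearTerm b)

  toAtom : Condition C n → Atomic (UniformScalar C) (UniformPred C) (Fin n)
  toAtom (b , d) = conditionAtom b d (zero? (Q.num (value d)))

  module _ {m ℓm : Level} (M : MSpec) (M∈C : M ∈ C) (N : Module (LR.commutativeRing M) m ℓm) where
    open Module N
    open Lin M N
    open Semantics (atM M) using (eval; _⊨ᵃ_[_]; _⊨_[_])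

    specializeScalar : UniformScalar C → L.Fraction M
    specializeScalar (_ , q∈) = proj₁ (q∈ M M∈C)

    specializePred : UniformPred C → Divisibility.Γ⁺ (atM M)
    specializePred (δ , δ⁺) = imageΓ M δ , δ⁺ M M∈C

    eval-foldr : ∀ {X} (ρ : X → Carrierᴹ) (ts : Fin n → Term (UniformScalar C) (UniformPred C) X) →
                 eval N ρ (mapTerm specializeScalar specializePred (Vec.foldr _⊞_ 𝟎 ts)) ≡
                 sum (λ j → eval N ρ (mapTerm specializeScalar specializePred (ts j)))
    eval-foldr {zero}  ρ ts = ≡.refl
    eval-foldr {suc n} ρ ts =
      ≡.cong (eval N ρ (mapTerm specializeScalar specializePred (ts zero)) +ᴹ_) (eval-foldr ρ (ts ∘ suc))

    eval-linearTerm : (b : Fin n → Scalar C) (z : Fin n → Carrierᴹ) →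
                      eval N z (mapTerm specializeScalar specializePred (linearTerm b)) ≈ᴹ
                      lin (λ j → ⟦ b j ⟧ M M∈C) z
    eval-linearTerm b z = ≈ᴹ-reflexive (eval-foldr z (λ j → var j ∙ toUniform (b j)))

    conditionAtom⇔holds : ∀ (b : Fin n → Scalar C) d (d≈0? : Dec (Q.num (value d) ≈ 0#)) z →
      _⊨ᵃ_[_] N (mapAtomic specializeScalar specializePred (conditionAtom b d d≈0?)) z ⇔
      HoldsAt M M∈C N z (b , d)
    conditionAtom⇔holds b d (yes d≈0) z = mk⇔
      (λ (lift eq) → 0ᴹ , ≈ᴹ-trans (≈ᴹ-sym (eval-linearTerm b z)) (≈ᴹ-trans eq (≈ᴹ-sym (*ᵣ-zeroˡ _))))
      (λ (y , eq) → lift (≈ᴹ-trans (eval-linearTerm b z) (≈ᴹ-trans eq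
        (≈ᴹ-trans (*ᵣ-congˡ {y} {⟦ d ⟧ M M∈C} {L.ι M 0#} ⟦d⟧≃0) (*ᵣ-zeroʳ y)))))
      where
      ⟦d⟧≃0 : L._≃_ M (⟦ d ⟧ M M∈C) (L.ι M 0#)
      ⟦d⟧≃0 = QR.trans {atM⊆Q M (⟦ d ⟧ M M∈C)} {value d} {Q.ι 0#}
        (proj₂ (liesIn d M M∈C)) (Q.num≈0⇒≃0 (value d) d≈0)
    conditionAtom⇔holds b d (no _) z = mk⇔
      (λ (y , eq) → y , ≈ᴹ-trans (≈ᴹ-sym (eval-linearTerm b z)) eq)
      (λ (y , eq) → y , ≈ᴹ-trans (eval-linearTerm b z) eq)

    atom⇔holds : (z : Fin n → Carrierᴹ) (x : Condition C n) →
                 _⊨ᵃ_[_] N (mapAtomic specializeScalar specializePred (toAtom x)) z ⇔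
                 HoldsAt M M∈C N z x
    atom⇔holds z (b , d) = conditionAtom⇔holds b d (zero? (Q.num (value d))) z

    conjunction⇔holds : (cs : List (Condition C n)) (z : Fin n → Carrierᴹ) →
                        All (HoldsAt M M∈C N z) cs ⇔
                        _⊨_[_] N (specialize C M M∈C (List.map toAtom cs)) z
    conjunction⇔holds cs z = mk⇔
      (All.map⁺ ∘ All.map⁺ ∘ All.map (λ {x} → Equivalence.from (atom⇔holds z x)))
      (All.map (λ {x} → Equivalence.to (atom⇔holds z x)) ∘ All.map⁻ ∘ All.map⁻)

  -- One variable at a fixed maximal ideal.

  module _ (M : MSpec) where
    open Divisors (atM M)

    zeroAt? : ∀ x → Dec (L._≃_ M x (L.ι M 0#))
    zeroAt? x with zero? (L.num {M} x)
    ... | yes x≈0 = yes (L.num≈0⇒≃0 M x x≈0)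
    ... | no  x≉0 = no (x≉0 ∘ L.≃0⇒num≈0 M x)

    -- The argument of `compare` for a single M, with excluded middle in place of a branching on x′.
    totalAt : ∀ x y → x ∣ y ⊎ y ∣ x
    totalAt x y with zero? (L.num {M} x)
    ... | yes x≈0 = inj₂ (L.ι M 0# , LR.trans M {L._⊗_ M y (L.ι M 0#)} {L.ι M 0#} {x}
      (LR.zeroʳ M y) (LR.sym M {x} {L.ι M 0#} (L.num≈0⇒≃0 M x x≈0)))
    ... | no p≉0 = decide em
      where
      open GCD (gcd B (L.num {M} x * L.den {M} y) (L.num {M} y * L.den {M} x)
        (nonzero-* integralDomain p≉0 (MultiplicativeSubset.nonzero (complement M) (L.den∈S {M} y))))
      decide : Dec (MaximalIdeal.Member M x′) → x ∣ y ⊎ y ∣ x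
      decide (yes x′∈M) = inj₂
        (record { num = x′ ; den = y′ ; den∈S = coprime∉ M {r} {x′} {s} {y′} rx+sy≈1 x′∈M } ,
         cross-ratio y≈ x≈)
      decide (no x′∉M) = inj₁ (record { num = y′ ; den = x′ ; den∈S = x′∉M } , cross-ratio x≈ y≈)

  module _ (m ℓm : Level) where

    module _ (M : MSpec) (M∈C : M ∈ C) where
      open NormalForms (atM M) (zeroAt? M) (λ _ _ → em) (totalAt M)

      pair : Condition C 1 → L.Fraction M × L.Fraction M
      pair (b , d) = ⟦ b zero ⟧ M M∈C , ⟦ d ⟧ M M∈C

      conditions⇔pairs : ∀ (cs : List (Condition C 1)) N z →
        All (HoldsAt M M∈C N z) cs ⇔ All (λ (b , d) → _⊩_∈_∙_ m ℓm N b d (z zero)) (List.map pair cs)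
      conditions⇔pairs cs N z = mk⇔
        -- A linear form in one variable evaluates to z.b + 0; the final zero is removed here and
        -- restored below.
        (All.map⁺ ∘ All.map (λ (y , eq) → y , ≈ᴹ-trans (≈ᴹ-sym (+ᴹ-identityʳ _)) eq))
        (All.map (λ (y , eq) → y , ≈ᴹ-trans (+ᴹ-identityʳ _) eq) ∘ All.map⁻)
        where open Module N

      localNormalForm : ∀ {φ : PPFormula integralDomain 1} → FormulaSolved m ℓm φ C →
        Σ (NormalForm (atM M)) λ ψ →
        Semantics.EquivalentInMod (atM M) m ℓm (φ at M) (NormalForm.formula ψ)
      localNormalForm (cs , φ⇔cs) = let ψ , pairs⇔ψ = toNormalForm m ℓm (List.map pair cs) in
        ψ , λ N z → ⇔.trans (φ⇔cs M M∈C N z) (⇔.trans (conditions⇔pairs cs N z) (pairs⇔ψ N z))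

theorem3p2 :
    ∀ {c ℓ} m ℓm → ExcludedMiddle (c ⊔ ℓ) → (B : BézoutDomain c ℓ) →
    let open BézoutDomain B
        open AtMaximal integralDomain
    in
    ( ∀ n (φ : PPFormula integralDomain n) →
      Σ ℕ λ K →
      Σ (Fin K → Constructible commutativeRing) λ C →
        (∀ (M : MSpec) → Σ (Fin K) λ k → M ∈ C k)
      × (∀ k →
         Σ (UniformConjunction (C k) (Fin n)) λ χ →
         ∀ (M : MSpec) (M∈C : M ∈ C k) →
         Semantics.EquivalentInMod (atM M) m ℓm (φ at M) (specialize (C k) M M∈C χ)) )
    ×
    ( ∀ (M : MSpec) (φ : PPFormula integralDomain 1) →
      Σ (NormalForm (atM M)) λ ψ →
      Semantics.EquivalentInMod (atM M) m ℓm (φ at M) (NormalForm.formula ψ) )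
theorem3p2 {c} {ℓ} m ℓm em B = uniform , local
  where
  open Uniform em B
  open BézoutDomain B hiding (zero)
  open AtMaximal integralDomain

  pieces : ∀ {n} (φ : PPFormula integralDomain n) → List (Σ Subset (FormulaSolved m ℓm φ))
  pieces φ = leaves (solved φ)

  cover : ∀ {n} (φ : PPFormula integralDomain n) M → Any (λ (D , _) → M ∈ D) (pieces φ)
  cover φ M = leaves-cover (solved φ) M (MaximalIdeal.0∈ M)

  uniform : ∀ n (φ : PPFormula integralDomain n) →
      Σ ℕ λ K →
      Σ (Fin K → Constructible commutativeRing) λ C →
        (∀ (M : MSpec) → Σ (Fin K) λ k → M ∈ C k)
      × (∀ k →
         Σ (UniformConjunction (C k) (Fin n)) λ χ →
         ∀ (M : MSpec) (M∈C : M ∈ C k) →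
         Semantics.EquivalentInMod (atM M) m ℓm (φ at M) (specialize (C k) M M∈C χ))
  uniform n φ = length (pieces φ) , proj₁ ∘ List.lookup (pieces φ) ,
    (λ M → Any.index (cover φ M) , Any.lookup-index (cover φ M)) ,
    λ k → let cs , eqv = proj₂ (List.lookup (pieces φ) k) in
    List.map toAtom cs , λ M M∈C N z →
    ⇔.trans (eqv M M∈C N z) (conjunction⇔holds M M∈C N cs z)

  -- Some leaf of the uniform elimination contains M; its conditions, read in B_M, are brought to
  -- normal form.
  local : ∀ (M : MSpec) (φ : PPFormula integralDomain 1) →
          Σ (NormalForm (atM M)) λ ψ →
          Semantics.EquivalentInMod (atM M) m ℓm (φ at M) (NormalForm.formula ψ)
  local M φ = localNormalForm m ℓm M (Any.lookup-index (cover φ M))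
    (proj₂ (List.lookup (pieces φ) (Any.index (cover φ M))))
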